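{- Let $\Sigma$ be a signature and $G=(G,\sigma,\theta):\mathcal F_\Sigma\to\mathcal C$ a cwf morphism (under the standing assumptions below). Let $S$ be a type symbol not declared in $\Sigma$ and $\Gamma_S$ a precontext with ($\Gamma_S$ context)$\in\mathcal J(\Sigma)$, so that $\Sigma'=\Sigma\cup\{(\Gamma_S,S)\}$ is a signature. Then for every $A\in\mathrm{Ty}_{\mathcal C}(G(\Gamma_S))$ there is a unique cwf morphism $G'=(G',\sigma',\theta'):\mathcal F_{\Sigma'}\to\mathcal C$ with $G'\circ E=G$ and $\sigma'(\Gamma_S,S(\mathrm{OV}(\Gamma_S)))=A$, where $E:\mathcal F_\Sigma\to\mathcal F_{\Sigma'}$ is the canonical embedding.
   Context: Standing assumptions: the variable set is $V=\{1,2,3,\ldots\}$ with $\mathsf{fr}(X)=\max(\{1\}\cup\{x+1:x\in X\})$ and $\varphi(X)=\{\mathsf{fr}(X)\}$ for finite $X\subseteq V$; all declarations of signatures are on standard form, written $(\Gamma,S)$ (type) and $(\Gamma,f,U)$ (function). Preelements are terms built from variables and function symbols; a pretype is $S(t_1,\ldots,t_n)$ with $S$ a type symbol and $t_i$ preelements; $\mathrm{V}(E)$ is the set of variables of $E$; $E[\bar a/\bar x]$ is simultaneous substitution. A precontext is $\Gamma=x_1:A_1,\ldots,x_n:A_n$ with $x_k=\mathsf{fr}(\{x_1,\ldots,x_{k-1}\})$ and $\mathrm{V}(A_k)\subseteq\{x_1,\ldots,x_{k-1}\}$; $\mathrm{OV}(\Gamma)=x_1,\ldots,x_n$; $\mathrm{fresh}(\Gamma)=\mathsf{fr}(\{x_1,\ldots,x_n\})$;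 $E[\bar a/\Gamma]=E[\bar a/x_1,\ldots,x_n]$. A presignature is a set of declarations $(\Gamma,S)$ ($S$ a type symbol) and $(\Gamma,f,U)$ ($f$ a function symbol, $U$ a pretype with $\mathrm{V}(U)\subseteq\mathrm{V}(\Gamma)$), each symbol declared at most once. $\mathcal{J}(\Sigma)$ is the smallest set of judgements ("$\Gamma$ context", "$A$ type $(\Gamma)$", "$a:A\ (\Gamma)$") closed under: (R1) $\langle\rangle$ context; (R2) from $\Gamma$ context and $A$ type $(\Gamma)$ infer $\Gamma,\mathrm{fresh}(\Gamma):A$ context; (R3) from $x_1:A_1,\ldots,x_n:A_n$ context infer $x_i:A_i\ (x_1:A_1,\ldots,x_n:A_n)$; (R4) if $(\Gamma,S)\in\Sigma$ and $\bar a:\Delta\to\Gamma$ infer $S(\bar a)$ type $(\Delta)$; (R5) if $(\Gamma,f,U)\in\Sigma$, $\bar a:\Delta\to\Gamma$ and $U[\bar a/\Gamma]$ type $(\Delta)$ infer $f(\bar a):U[\bar a/\Gamma]\ (\Delta)$; where, for $\Gamma=x_1:A_1,\ldots,x_n:A_n$, "$\bar a:\Delta\to\Gamma$" abbreviates the judgements $\Delta$ context, $\Gamma$ context, $a_k:A_k[a_1,\ldots,a_{k-1}/x_1,\ldots,x_{k-1}]\ (\Delta)$ ($k=1,\ldots,n$). $\Sigma$ is a signature if ($\Gamma$ context)$\in\mathcal{J}(\Sigma)$ for $(\Gamma,S)\in\Sigma$ and ($U$ type $(\Gamma)$)$\in\mathcal{J}(\Sigma)$ for $(\Gamma,f,U)\in\Sigma$.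 A category with families (cwf) consists of: a category $\mathcal C$ with a terminal object $\top$; for each object $\Gamma$ a class $\mathrm{Ty}(\Gamma)$, and for $f:\Delta\to\Gamma$ a function $A\mapsto A\{f\}:\mathrm{Ty}(\Gamma)\to\mathrm{Ty}(\Delta)$ with $A\{1\}=A$, $A\{f\circ g\}=A\{f\}\{g\}$; for $A\in\mathrm{Ty}(\Gamma)$ an object $\Gamma.A$ and a morphism $\mathrm{p}(A)=\mathrm{p}_\Gamma(A):\Gamma.A\to\Gamma$; for $A\in\mathrm{Ty}(\Gamma)$ a class $\mathrm{Tm}(\Gamma,A)$ and for $f:\Delta\to\Gamma$ a function $a\mapsto a\{f\}:\mathrm{Tm}(\Gamma,A)\to\mathrm{Tm}(\Delta,A\{f\})$ with $a\{1\}=a$, $a\{f\circ g\}=a\{f\}\{g\}$; for each $A\in\mathrm{Ty}(\Gamma)$ an element $\mathrm{v}_A\in\mathrm{Tm}(\Gamma.A,A\{\mathrm{p}(A)\})$; for $f:\Delta\to\Gamma$ and $a\in\mathrm{Tm}(\Delta,A\{f\})$ a morphism $\langle f,a\rangle_A:\Delta\to\Gamma.A$ such that $\mathrm{p}(A)\circ\langle f,a\rangle_A=f$, $\mathrm{v}_A\{\langle f,a\rangle_A\}=a$, $\langle\mathrm{p}(A)\circ h,\mathrm{v}_A\{h\}\rangle_A=h$ for every $h:\Delta\to\Gamma.A$, and $\langle f,a\rangle_A\circ g=\langle f\circ g,a\{g\}\rangle_A$. A cwf morphism $(F,\sigma,\theta):\mathcal C\to\mathcal C'$ consists of a functor $F$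 with $F(\top)=\top'$; functions $\sigma_\Gamma:\mathrm{Ty}(\Gamma)\to\mathrm{Ty}'(F\Gamma)$ with $\sigma_\Delta(A\{f\})=\sigma_\Gamma(A)\{Ff\}$ for $f:\Delta\to\Gamma$, such that $F(\Gamma.A)=F\Gamma.\sigma_\Gamma(A)$ and $F(\mathrm{p}_\Gamma(A))=\mathrm{p}_{F\Gamma}(\sigma_\Gamma(A))$; and functions $\theta_{\Gamma,A}:\mathrm{Tm}(\Gamma,A)\to\mathrm{Tm}'(F\Gamma,\sigma_\Gamma(A))$ with $\theta_{\Delta,A\{f\}}(a\{f\})=\theta_{\Gamma,A}(a)\{Ff\}$, $\theta_{\Gamma.A,A\{\mathrm{p}(A)\}}(\mathrm{v}_A)=\mathrm{v}_{\sigma_\Gamma(A)}$, and $F(\langle f,a\rangle_A)=\langle Ff,\theta_{\Delta,A\{f\}}(a)\rangle_{\sigma_\Gamma(A)}$ for $f:\Delta\to\Gamma$, $a\in\mathrm{Tm}(\Delta,A\{f\})$. The cwf $\mathcal F_\Sigma$: objects are precontexts $\Gamma$ with ($\Gamma$ context)$\in\mathcal{J}(\Sigma)$; morphisms $\Delta\to\Gamma$ are triples $(\Delta,\Gamma,\bar a)$ with $\bar a:\Delta\to\Gamma$ a context map in $\mathcal{J}(\Sigma)$; composition $(\Gamma,\Theta,\bar t)\circ(\Delta,\Gamma,\bar s)=(\Delta,\Theta,(t_1[\bar s/\Gamma],\ldots,t_k[\bar s/\Gamma]))$; identity $(\Gamma,\Gamma,\mathrm{OV}(\Gamma))$; terminal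 object $\langle\rangle$. $\mathrm{Ty}(\Gamma)=\{(\Gamma,A): (A\text{ type }(\Gamma))\in\mathcal{J}(\Sigma)\}$ with $(\Gamma,A)\{(\Delta,\Gamma,\bar a)\}=(\Delta,A[\bar a/\Gamma])$; $\mathrm{Tm}(\Gamma,(\Gamma,A))=\{((\Gamma,A),a): (a:A\ (\Gamma))\in\mathcal{J}(\Sigma)\}$ with $((\Gamma,A),a)\{(\Delta,\Gamma,\bar a)\}=((\Delta,A[\bar a/\Gamma]),a[\bar a/\Gamma])$; for $\mathrm S=(\Gamma,S)$: $\Gamma.\mathrm S=\langle\Gamma,\mathrm{fresh}(\Gamma):S\rangle$, $\mathrm{p}_\Gamma(\mathrm S)=(\Gamma.\mathrm S,\Gamma,\mathrm{OV}(\Gamma))$, $\mathrm{v}_{\mathrm S}=((\Gamma.\mathrm S,S),\mathrm{fresh}(\Gamma))$, $\langle(\Delta,\Gamma,\bar s),((\Delta,S[\bar s/\Gamma]),b)\rangle_{\mathrm S}=(\Delta,\Gamma.\mathrm S,(\bar s,b))$. For a cwf morphism $(F,\sigma,\theta)$ out of $\mathcal F_\Sigma$ write $\sigma(\Gamma,A)$ for $\sigma_\Gamma((\Gamma,A))$ and $\theta(\Gamma,A,a)$ for $\theta_{\Gamma,(\Gamma,A)}(((\Gamma,A),a))$. For signatures $\Sigma\subseteq\Sigma'$, the canonical embedding $E:\mathcal F_\Sigma\to\mathcal F_{\Sigma'}$ is the cwf morphism which is the identity on objects, morphisms, types and terms. -}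

module Defs where

open import Level using (Level; 0ℓ; _⊔_) renaming (suc to lsuc)
open import Data.Empty using (⊥-elim)
open import Data.List.Base using (List; []; _∷_; _++_; foldr; length; map)
open import Data.List.Membership.Propositional using (_∈_)
open import Data.List.Membership.Propositional.Properties using (∈-++⁺ˡ; ∈-++⁺ʳ; ∈-++⁻)
open import Data.List.Relation.Binary.Subset.Propositional using (_⊆_)
open import Data.List.Relation.Unary.Any using (here; there)
open import Data.Nat.Base as ℕ using (ℕ; suc; _<_)
open import Data.Nat.Properties using (_≟_; ≤-trans; <-irrefl; m≤m⊔n; m≤n⊔m; suc-injective)
open import Data.Product.Base using (_×_; _,_; proj₁; proj₂)
open import Data.Sum.Base using (_⊎_; inj₁; inj₂; [_,_]′)
open import Function.Base using (_$_)
open import Relation.Binary.HeterogeneousEquality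
  using (_≅_; refl; ≅-to-≡; ≡-to-≅; ≡-subst-removable)
  renaming (sym to ≅-sym; trans to ≅-trans)
open import Relation.Binary.PropositionalEquality
  using (_≡_; _≢_; refl; sym; trans; cong; cong₂; subst)
open import Relation.Nullary using (¬_; yes; no; contradiction)
open import Relation.Nullary.Irrelevant using () renaming (Irrelevant to IsProp)
open import Relation.Unary using (Pred; _∪_; ｛_｝) renaming (_⊆_ to _⊆ₚ_; _∈_ to _∈ₚ_)

-- Everything is strict, as in set theory: equality is _≡_.  Where the two
-- sides of an equation live in types that are only propositionally equal,
-- _≅_ is used; where a term has to be retyped before it can be used, subst.
record Cwf (o h t m : Level) : Set (lsuc (o ⊔ h ⊔ t ⊔ m)) where
  infixr 9 _∘_
  infixl 8 _[_] _[_]ₜ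
  infixl 5 _▹_
  field
    Ob  : Set o
    Hom : Ob → Ob → Set h
    id  : ∀ {Γ} → Hom Γ Γ
    _∘_ : ∀ {Δ Γ Θ} → Hom Γ Θ → Hom Δ Γ → Hom Δ Θ
    identityˡ : ∀ {Δ Γ} (f : Hom Δ Γ) → id ∘ f ≡ f
    identityʳ : ∀ {Δ Γ} (f : Hom Δ Γ) → f ∘ id ≡ f
    assoc     : ∀ {Ξ Δ Γ Θ} (f : Hom Γ Θ) (g : Hom Δ Γ) (h : Hom Ξ Δ) →
                (f ∘ g) ∘ h ≡ f ∘ (g ∘ h)

    ⊤        : Ob
    !        : ∀ {Γ} → Hom Γ ⊤
    !-unique : ∀ {Γ} (f : Hom Γ ⊤) → f ≡ !

    Ty   : Ob → Set t
    _[_] : ∀ {Δ Γ} → Ty Γ → Hom Δ Γ → Ty Δ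
    [id] : ∀ {Γ} (A : Ty Γ) → A [ id ] ≡ A
    [∘]  : ∀ {Ξ Δ Γ} (A : Ty Γ) (f : Hom Δ Γ) (g : Hom Ξ Δ) →
           A [ f ∘ g ] ≡ A [ f ] [ g ]

    _▹_ : (Γ : Ob) → Ty Γ → Ob
    p   : ∀ {Γ} (A : Ty Γ) → Hom (Γ ▹ A) Γ

    Tm    : (Γ : Ob) → Ty Γ → Set m
    _[_]ₜ : ∀ {Δ Γ} {A : Ty Γ} → Tm Γ A → (f : Hom Δ Γ) → Tm Δ (A [ f ])
    [id]ₜ : ∀ {Γ} {A : Ty Γ} (a : Tm Γ A) → a [ id ]ₜ ≅ a
    [∘]ₜ  : ∀ {Ξ Δ Γ} {A : Ty Γ} (a : Tm Γ A) (f : Hom Δ Γ) (g : Hom Ξ Δ) →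
            a [ f ∘ g ]ₜ ≅ a [ f ]ₜ [ g ]ₜ

    v : ∀ {Γ} (A : Ty Γ) → Tm (Γ ▹ A) (A [ p A ])

    -- ⟨ A ∣ f , a ⟩ is ⟨f,a⟩_A.
    ⟨_∣_,_⟩ : ∀ {Δ Γ} (A : Ty Γ) (f : Hom Δ Γ) → Tm Δ (A [ f ]) → Hom Δ (Γ ▹ A)
    p-⟨⟩  : ∀ {Δ Γ} (A : Ty Γ) (f : Hom Δ Γ) (a : Tm Δ (A [ f ])) →
            p A ∘ ⟨ A ∣ f , a ⟩ ≡ f
    v-⟨⟩  : ∀ {Δ Γ} (A : Ty Γ) (f : Hom Δ Γ) (a : Tm Δ (A [ f ])) →
            v A [ ⟨ A ∣ f , a ⟩ ]ₜ ≅ a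
    ⟨⟩-η  : ∀ {Δ Γ} (A : Ty Γ) (h : Hom Δ (Γ ▹ A)) →
            ⟨ A ∣ p A ∘ h , subst (Tm Δ) (sym ([∘] A (p A) h)) (v A [ h ]ₜ) ⟩ ≡ h
    ⟨⟩-∘  : ∀ {Ξ Δ Γ} (A : Ty Γ) (f : Hom Δ Γ) (a : Tm Δ (A [ f ])) (g : Hom Ξ Δ) →
            ⟨ A ∣ f , a ⟩ ∘ g
              ≡ ⟨ A ∣ f ∘ g , subst (Tm Ξ) (sym ([∘] A f g)) (a [ g ]ₜ) ⟩

record CwfMor {o h t m o′ h′ t′ m′ : Level} (C : Cwf o h t m) (D : Cwf o′ h′ t′ m′)
       : Set (o ⊔ h ⊔ t ⊔ m ⊔ o′ ⊔ h′ ⊔ t′ ⊔ m′) where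
  private
    module C = Cwf C
    module D = Cwf D
  field
    F₀   : C.Ob → D.Ob
    F₁   : ∀ {Δ Γ} → C.Hom Δ Γ → D.Hom (F₀ Δ) (F₀ Γ)
    F-id : ∀ {Γ} → F₁ (C.id {Γ}) ≡ D.id
    F-∘  : ∀ {Δ Γ Θ} (f : C.Hom Γ Θ) (g : C.Hom Δ Γ) → F₁ (f C.∘ g) ≡ F₁ f D.∘ F₁ g
    F-⊤  : F₀ C.⊤ ≡ D.⊤

    σ    : ∀ {Γ} → C.Ty Γ → D.Ty (F₀ Γ)
    σ-[] : ∀ {Δ Γ} (A : C.Ty Γ) (f : C.Hom Δ Γ) → σ (A C.[ f ]) ≡ σ A D.[ F₁ f ]
    F-▹  : ∀ {Γ} (A : C.Ty Γ) → F₀ (Γ C.▹ A) ≡ F₀ Γ D.▹ σ A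
    F-p  : ∀ {Γ} (A : C.Ty Γ) → F₁ (C.p A) ≅ D.p (σ A)

    θ    : ∀ {Γ} {A : C.Ty Γ} → C.Tm Γ A → D.Tm (F₀ Γ) (σ A)
    θ-[] : ∀ {Δ Γ} {A : C.Ty Γ} (a : C.Tm Γ A) (f : C.Hom Δ Γ) →
           θ (a C.[ f ]ₜ) ≅ θ a D.[ F₁ f ]ₜ
    θ-v  : ∀ {Γ} (A : C.Ty Γ) → θ (C.v A) ≅ D.v (σ A)
    F-⟨⟩ : ∀ {Δ Γ} (A : C.Ty Γ) (f : C.Hom Δ Γ) (a : C.Tm Δ (A C.[ f ])) →
           F₁ C.⟨ A ∣ f , a ⟩
             ≅ D.⟨ σ A ∣ F₁ f , subst (D.Tm (F₀ Δ)) (σ-[] A f) (θ a) ⟩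

-- Equality of cwf morphisms, i.e. equality of each of the component functions
-- at every argument.
module _ {o h t m o′ h′ t′ m′ : Level} {C : Cwf o h t m} {D : Cwf o′ h′ t′ m′} where

  infix 4 _≈_

  record _≈_ (F G : CwfMor C D) : Set (o ⊔ h ⊔ t ⊔ m ⊔ o′ ⊔ h′ ⊔ t′ ⊔ m′) where
    private
      module C = Cwf C
      module F = CwfMor F
      module G = CwfMor G
    field
      ≈-Ob  : (Γ : C.Ob) → F.F₀ Γ ≡ G.F₀ Γ
      ≈-Hom : ∀ {Δ Γ} (f : C.Hom Δ Γ) → F.F₁ f ≅ G.F₁ f
      ≈-Ty  : ∀ {Γ} (A : C.Ty Γ) → F.σ A ≅ G.σ A
      ≈-Tm  : ∀ {Γ} {A : C.Ty Γ} (a : C.Tm Γ A) → F.θ a ≅ G.θ a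

module CwfMor-cong {o h t m o′ h′ t′ m′ : Level} {C : Cwf o h t m} {D : Cwf o′ h′ t′ m′}
                   (F : CwfMor C D) where
  private
    module C = Cwf C
    module D = Cwf D
  open CwfMor F

  F₁-cong : ∀ {Δ Δ′ Γ Γ′} {f : C.Hom Δ Γ} {g : C.Hom Δ′ Γ′} →
            Δ ≡ Δ′ → Γ ≡ Γ′ → f ≅ g → F₁ f ≅ F₁ g
  F₁-cong refl refl refl = refl

  θ-cong : ∀ {Γ Γ′} {A : C.Ty Γ} {A′ : C.Ty Γ′} {a : C.Tm Γ A} {a′ : C.Tm Γ′ A′} →
           Γ ≡ Γ′ → A ≅ A′ → a ≅ a′ → θ a ≅ θ a′
  θ-cong refl refl refl = refl

module Cwf-cong {o h t m : Level} (C : Cwf o h t m) where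
  open Cwf C

  []-cong : ∀ {Δ Δ′ Γ} {A : Ty Γ} {f : Hom Δ Γ} {g : Hom Δ′ Γ} →
            Δ ≡ Δ′ → f ≅ g → A [ f ] ≅ A [ g ]
  []-cong refl refl = refl

  ⟨⟩-cong : ∀ {Δ Γ} {A : Ty Γ} {f g : Hom Δ Γ} {a : Tm Δ (A [ f ])} {b : Tm Δ (A [ g ])} →
            f ≡ g → a ≅ b → ⟨ A ∣ f , a ⟩ ≡ ⟨ A ∣ g , b ⟩
  ⟨⟩-cong refl refl = refl

  ⟨⟩-congᵀ : ∀ {Δ Γ} {A B : Ty Γ} {f : Hom Δ Γ} {a : Tm Δ (A [ f ])} {b : Tm Δ (B [ f ])} →
             A ≡ B → a ≅ b → ⟨ A ∣ f , a ⟩ ≅ ⟨ B ∣ f , b ⟩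
  ⟨⟩-congᵀ refl refl = refl

infixr 9 _∘ᶜ_

_∘ᶜ_ : ∀ {o h t m o′ h′ t′ m′ o″ h″ t″ m″ : Level}
       {C : Cwf o h t m} {D : Cwf o′ h′ t′ m′} {E : Cwf o″ h″ t″ m″} →
       CwfMor D E → CwfMor C D → CwfMor C E
_∘ᶜ_ {C = C} {D = D} {E = E} G F = record
  { F₀   = λ Γ → G.F₀ (F.F₀ Γ)
  ; F₁   = λ f → G.F₁ (F.F₁ f)
  ; F-id = trans (cong G.F₁ F.F-id) G.F-id
  ; F-∘  = λ f g → trans (cong G.F₁ (F.F-∘ f g)) (G.F-∘ _ _)
  ; F-⊤  = trans (cong G.F₀ F.F-⊤) G.F-⊤
  ; σ    = λ A → G.σ (F.σ A)
  ; σ-[] = λ A f → trans (cong G.σ (F.σ-[] A f)) (G.σ-[] _ _)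
  ; F-▹  = λ A → trans (cong G.F₀ (F.F-▹ A)) (G.F-▹ _)
  ; F-p  = λ A → ≅-trans (F₁-cong (F.F-▹ A) refl (F.F-p A)) (G.F-p _)
  ; θ    = λ a → G.θ (F.θ a)
  ; θ-[] = λ {_} {_} {A} a f →
      ≅-trans (θ-cong refl (≡-to-≅ (F.σ-[] A f)) (F.θ-[] a f)) (G.θ-[] _ _)
  ; θ-v  = λ A →
      ≅-trans (θ-cong (F.F-▹ A)
                      (≅-trans (≡-to-≅ (F.σ-[] A _)) ([]-cong (F.F-▹ A) (F.F-p A)))
                      (F.θ-v A))
              (G.θ-v _)
  ; F-⟨⟩ = λ A f a →
      ≅-trans (F₁-cong refl (F.F-▹ A) (F.F-⟨⟩ A f a)) $
      ≅-trans (G.F-⟨⟩ (F.σ A) (F.F₁ f) _) $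
      ≡-to-≅ $ E-cong.⟨⟩-cong refl $
      ≅-trans (≡-subst-removable (E.Tm _) _ _) $
      ≅-trans (θ-cong refl (≡-to-≅ (sym (F.σ-[] A f)))
                           (≡-subst-removable (D.Tm _) (F.σ-[] A f) (F.θ a))) $
      ≅-sym (≡-subst-removable (E.Tm _) _ _)
  }
  where
  module D = Cwf D
  module E = Cwf E
  module F = CwfMor F
  module G = CwfMor G
  open CwfMor-cong G
  open Cwf-cong D using ([]-cong)
  module E-cong = Cwf-cong E

-- The number n stands for the variable n + 1 of V = {1,2,3,…}.  Under this
-- order isomorphism fr(X) = max({1} ∪ {x + 1 : x ∈ X}) reads as below.
V : Set
V = ℕ

fr : List V → V
fr X = foldr ℕ._⊔_ 0 (map suc X)

fr-fresh : ∀ {x} X → x ∈ X → x < fr X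
fr-fresh (y ∷ X) (here refl) = m≤m⊔n (suc y) (fr X)
fr-fresh (y ∷ X) (there x∈X) = ≤-trans (fr-fresh X x∈X) (m≤n⊔m (suc y) (fr X))

-- Finite sequences x₁,…,xₙ of elements, of variables and of context entries
-- grow to the right in the rules; as lists they are kept in reverse, the head
-- being the last entry xₙ.

module Syntax (TySym FunSym : Set) where

  data PreEl : Set where
    var : V → PreEl
    fn  : FunSym → List PreEl → PreEl

  data PreTy : Set where
    ty : TySym → List PreEl → PreTy

  V⟨_⟩ₑ : PreEl → List V
  V⟨_⟩ₛ : List PreEl → List V
  V⟨ var x ⟩ₑ   = x ∷ []
  V⟨ fn f as ⟩ₑ = V⟨ as ⟩ₛ
  V⟨ [] ⟩ₛ      = []
  V⟨ a ∷ as ⟩ₛ  = V⟨ a ⟩ₑ ++ V⟨ as ⟩ₛ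

  V⟨_⟩ : PreTy → List V
  V⟨ ty S as ⟩ = V⟨ as ⟩ₛ

  -- The simultaneous substitutions E[as/xs].  The xs are meant to be distinct
  -- and as many as the as; variables not among the xs are left unchanged.
  _[_/_]ᵥ : V → List PreEl → List V → PreEl
  y [ []     / xs     ]ᵥ = var y
  y [ a ∷ as / []     ]ᵥ = var y
  y [ a ∷ as / x ∷ xs ]ᵥ with y ≟ x
  ... | yes _ = a
  ... | no  _ = y [ as / xs ]ᵥ

  _[_/_]ₑ : PreEl → List PreEl → List V → PreEl
  _[_/_]ₛ : List PreEl → List PreEl → List V → List PreEl
  var y   [ as / xs ]ₑ = y [ as / xs ]ᵥ
  fn f bs [ as / xs ]ₑ = fn f (bs [ as / xs ]ₛ)
  []       [ as / xs ]ₛ = []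
  (b ∷ bs) [ as / xs ]ₛ = b [ as / xs ]ₑ ∷ bs [ as / xs ]ₛ

  _[_/_]ₜ : PreTy → List PreEl → List V → PreTy
  ty S bs [ as / xs ]ₜ = ty S (bs [ as / xs ]ₛ)

  -- Since x_k = fr({x_1,…,x_{k-1}}) is determined by what precedes it, the
  -- variables of a precontext are computed rather than stored.  The scoping
  -- proof is irrelevant, so that precontexts are equal as soon as their
  -- pretypes are.
  data PreCtx : Set
  OV : PreCtx → List V

  data PreCtx where
    ⟨⟩  : PreCtx
    ext : (Γ : PreCtx) (A : PreTy) → .(V⟨ A ⟩ ⊆ OV Γ) → PreCtx

  OV ⟨⟩          = []
  OV (ext Γ A _) = fr (OV Γ) ∷ OV Γ

  fresh : PreCtx → V
  fresh Γ = fr (OV Γ)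

  data Declaration : Set where
    tyDecl  : PreCtx → TySym → Declaration
    funDecl : PreCtx → FunSym → PreTy → Declaration

  record PreSignature : Set₁ where
    field
      decls      : Pred Declaration 0ℓ
      -- decls is a set of declarations: membership carries no information.
      decls-prop : ∀ d → IsProp (d ∈ₚ decls)
      scoped     : ∀ {Γ f U} → funDecl Γ f U ∈ₚ decls → V⟨ U ⟩ ⊆ OV Γ
      ty-once    : ∀ {S Γ Γ′} → tyDecl Γ S ∈ₚ decls → tyDecl Γ′ S ∈ₚ decls → Γ ≡ Γ′
      fun-once   : ∀ {f Γ Γ′ U U′} → funDecl Γ f U ∈ₚ decls → funDecl Γ′ f U′ ∈ₚ decls →
                   Γ ≡ Γ′ × U ≡ U′

  open PreSignature

  data Judgement : Set where
    _context : PreCtx → Judgement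
    _type⟨_⟩ : PreTy → PreCtx → Judgement
    _∶_⟨_⟩   : PreEl → PreTy → PreCtx → Judgement

  data _∶_∈ᶜ_ : V → PreTy → PreCtx → Set where
    last    : ∀ {Γ A} .{sc : V⟨ A ⟩ ⊆ OV Γ} → fresh Γ ∶ A ∈ᶜ ext Γ A sc
    earlier : ∀ {x Γ A B} .{sc : V⟨ B ⟩ ⊆ OV Γ} → x ∶ A ∈ᶜ Γ → x ∶ A ∈ᶜ ext Γ B sc

  -- 𝒥 Σ j is the type of derivations of j; they are unique (𝒥-prop below), so
  -- it is the statement that j belongs to 𝒥(Σ).
  data 𝒥 (Σ : PreSignature) : Judgement → Set
  data CtxMap (Σ : PreSignature) (Δ : PreCtx) (as : List PreEl) (Γ : PreCtx) : Set
  data Args (Σ : PreSignature) (Δ : PreCtx) : List PreEl → PreCtx → Set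

  data 𝒥 Σ where
    R1 : 𝒥 Σ (⟨⟩ context)
    -- The side condition sc follows from the second premise (type-scoped).
    R2 : ∀ {Γ A} → 𝒥 Σ (Γ context) → 𝒥 Σ (A type⟨ Γ ⟩) →
         .(sc : V⟨ A ⟩ ⊆ OV Γ) → 𝒥 Σ (ext Γ A sc context)
    R3 : ∀ {Γ x A} → 𝒥 Σ (Γ context) → x ∶ A ∈ᶜ Γ → 𝒥 Σ (var x ∶ A ⟨ Γ ⟩)
    R4 : ∀ {Γ S Δ as} → tyDecl Γ S ∈ₚ decls Σ → CtxMap Σ Δ as Γ →
         𝒥 Σ (ty S as type⟨ Δ ⟩)
    R5 : ∀ {Γ f U Δ as} → funDecl Γ f U ∈ₚ decls Σ → CtxMap Σ Δ as Γ →
         𝒥 Σ (U [ as / OV Γ ]ₜ type⟨ Δ ⟩) → 𝒥 Σ (fn f as ∶ U [ as / OV Γ ]ₜ ⟨ Δ ⟩)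

  data CtxMap Σ Δ as Γ where
    ctxMap : 𝒥 Σ (Δ context) → 𝒥 Σ (Γ context) → Args Σ Δ as Γ → CtxMap Σ Δ as Γ

  data Args Σ Δ where
    []  : Args Σ Δ [] ⟨⟩
    _∷_ : ∀ {a as Γ A} .{sc : V⟨ A ⟩ ⊆ OV Γ} → 𝒥 Σ (a ∶ A [ as / OV Γ ]ₜ ⟨ Δ ⟩) → Args Σ Δ as Γ →
          Args Σ Δ (a ∷ as) (ext Γ A sc)

  record IsSignature (Σ : PreSignature) : Set where
    field
      ty-ok  : ∀ {Γ S} → tyDecl Γ S ∈ₚ decls Σ → 𝒥 Σ (Γ context)
      fun-ok : ∀ {Γ f U} → funDecl Γ f U ∈ₚ decls Σ → 𝒥 Σ (U type⟨ Γ ⟩)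

  record Signature : Set₁ where
    field
      preSig : PreSignature
      isSig  : IsSignature preSig
    open PreSignature preSig public
    open IsSignature isSig public

  open Signature using (preSig)

  fresh∉ : ∀ Γ → ¬ (fresh Γ ∈ OV Γ)
  fresh∉ Γ x∈ = <-irrefl refl (fr-fresh (OV Γ) x∈)

  idᵛ : ∀ y xs → y [ map var xs / xs ]ᵥ ≡ var y
  idᵛ y []       = refl
  idᵛ y (x ∷ xs) with y ≟ x
  ... | yes refl = refl
  ... | no _     = idᵛ y xs

  idₑ : ∀ a xs → a [ map var xs / xs ]ₑ ≡ a
  idₛ : ∀ as xs → as [ map var xs / xs ]ₛ ≡ as
  idₑ (var y) xs = idᵛ y xs
  idₑ (fn f as) xs = cong (fn f) (idₛ as xs)
  idₛ [] xs = refl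
  idₛ (a ∷ as) xs = cong₂ _∷_ (idₑ a xs) (idₛ as xs)

  idₜ : ∀ A xs → A [ map var xs / xs ]ₜ ≡ A
  idₜ (ty S as) xs = cong (ty S) (idₛ as xs)

  compᵛ : ∀ {y} as bs xs ys → length as ≡ length xs → y ∈ xs →
          (y [ as / xs ]ᵥ) [ bs / ys ]ₑ ≡ y [ as [ bs / ys ]ₛ / xs ]ᵥ
  compᵛ []       bs [] ys _ ()
  compᵛ {y} (a ∷ as) bs (x ∷ xs) ys e y∈ with y ≟ x
  ... | yes _  = refl
  ... | no y≢x with y∈
  ...   | here y≡x  = contradiction y≡x y≢x
  ...   | there y∈′ = compᵛ as bs xs ys (suc-injective e) y∈′

  module _ (as bs : List PreEl) (xs ys : List V) (e : length as ≡ length xs) where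
    compₑ : ∀ c → V⟨ c ⟩ₑ ⊆ xs → (c [ as / xs ]ₑ) [ bs / ys ]ₑ ≡ c [ as [ bs / ys ]ₛ / xs ]ₑ
    compₛ : ∀ cs → V⟨ cs ⟩ₛ ⊆ xs → (cs [ as / xs ]ₛ) [ bs / ys ]ₛ ≡ cs [ as [ bs / ys ]ₛ / xs ]ₛ
    compₑ (var y)   sc = compᵛ as bs xs ys e (sc (here refl))
    compₑ (fn f cs) sc = cong (fn f) (compₛ cs sc)
    compₛ []        sc = refl
    compₛ (c ∷ cs)  sc = cong₂ _∷_ (compₑ c (λ z → sc (∈-++⁺ˡ z)))
                                   (compₛ cs (λ z → sc (∈-++⁺ʳ V⟨ c ⟩ₑ z)))

    compₜ : ∀ A → V⟨ A ⟩ ⊆ xs → (A [ as / xs ]ₜ) [ bs / ys ]ₜ ≡ A [ as [ bs / ys ]ₛ / xs ]ₜ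
    compₜ (ty S cs) sc = cong (ty S) (compₛ cs sc)

  dropᵛ : ∀ {y x} a as xs → y ≢ x → y [ a ∷ as / x ∷ xs ]ᵥ ≡ y [ as / xs ]ᵥ
  dropᵛ {y} {x} a as xs y≢x with y ≟ x
  ... | yes y≡x = contradiction y≡x y≢x
  ... | no _    = refl

  headᵛ : ∀ x a as xs → x [ a ∷ as / x ∷ xs ]ᵥ ≡ a
  headᵛ x a as xs with x ≟ x
  ... | yes _  = refl
  ... | no x≢x = contradiction refl x≢x

  module _ (a : PreEl) (as : List PreEl) {x : V} (xs : List V) (x∉xs : ¬ x ∈ xs) where
    dropₑ : ∀ c → V⟨ c ⟩ₑ ⊆ xs → c [ a ∷ as / x ∷ xs ]ₑ ≡ c [ as / xs ]ₑ
    dropₛ : ∀ cs → V⟨ cs ⟩ₛ ⊆ xs → cs [ a ∷ as / x ∷ xs ]ₛ ≡ cs [ as / xs ]ₛ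
    dropₑ (var y)   sc = dropᵛ a as xs (λ { refl → x∉xs (sc (here refl)) })
    dropₑ (fn f cs) sc = cong (fn f) (dropₛ cs sc)
    dropₛ []        sc = refl
    dropₛ (c ∷ cs)  sc = cong₂ _∷_ (dropₑ c (λ z → sc (∈-++⁺ˡ z)))
                                   (dropₛ cs (λ z → sc (∈-++⁺ʳ V⟨ c ⟩ₑ z)))

    dropₜ : ∀ A → V⟨ A ⟩ ⊆ xs → A [ a ∷ as / x ∷ xs ]ₜ ≡ A [ as / xs ]ₜ
    dropₜ (ty S cs) sc = cong (ty S) (dropₛ cs sc)

  vars-scoped : ∀ xs → V⟨ map var xs ⟩ₛ ⊆ xs
  vars-scoped (x ∷ xs) (here y≡x) = here y≡x
  vars-scoped (x ∷ xs) (there y∈) = there (vars-scoped xs y∈)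

  vars-inst : ∀ {Γ : PreCtx} as → length as ≡ length (OV Γ) → map var (OV Γ) [ as / OV Γ ]ₛ ≡ as
  vars-inst {⟨⟩}        []       _ = refl
  vars-inst {ext Γ A _} (a ∷ as) e =
    cong₂ _∷_ (headᵛ (fresh Γ) a as (OV Γ))
              (trans (dropₛ a as (OV Γ) (fresh∉ Γ) (map var (OV Γ)) (vars-scoped (OV Γ)))
                     (vars-inst {Γ} as (suc-injective e)))

  entry∈ : ∀ {x A Γ} → x ∶ A ∈ᶜ Γ → x ∈ OV Γ
  entry∈ last        = here refl
  entry∈ (earlier l) = there (entry∈ l)

  module _ {Σ : PreSignature} where

    args-length : ∀ {Δ as Γ} → Args Σ Δ as Γ → length as ≡ length (OV Γ)
    args-length []       = refl
    args-length (_ ∷ as) = cong suc (args-length as)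

    type-scoped : ∀ {A Γ} → 𝒥 Σ (A type⟨ Γ ⟩) → V⟨ A ⟩ ⊆ OV Γ
    el-scoped   : ∀ {a A Γ} → 𝒥 Σ (a ∶ A ⟨ Γ ⟩) → V⟨ a ⟩ₑ ⊆ OV Γ
    args-scoped : ∀ {Δ as Γ} → Args Σ Δ as Γ → V⟨ as ⟩ₛ ⊆ OV Δ
    type-scoped (R4 _ (ctxMap _ _ as)) = args-scoped as
    el-scoped (R3 _ l) (here refl)     = entry∈ l
    el-scoped (R5 _ (ctxMap _ _ as) _) = args-scoped as
    args-scoped {as = a ∷ _} (d ∷ ds) x∈ =
      [ el-scoped d , args-scoped ds ]′ (∈-++⁻ V⟨ a ⟩ₑ x∈)

    module _ {B : PreTy} {Γ : PreCtx} .{sc : V⟨ B ⟩ ⊆ OV Γ}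
             (wf : 𝒥 Σ (ext Γ B sc context)) where
      weakenₜ : ∀ {A} → 𝒥 Σ (A type⟨ Γ ⟩) → 𝒥 Σ (A type⟨ ext Γ B sc ⟩)
      weakenₑ : ∀ {a A} → 𝒥 Σ (a ∶ A ⟨ Γ ⟩) → 𝒥 Σ (a ∶ A ⟨ ext Γ B sc ⟩)
      weakenₛ : ∀ {as Θ} → Args Σ Γ as Θ → Args Σ (ext Γ B sc) as Θ
      weakenₜ (R4 d (ctxMap _ c as))   = R4 d (ctxMap wf c (weakenₛ as))
      weakenₑ (R3 _ l)                 = R3 wf (earlier l)
      weakenₑ (R5 d (ctxMap _ c as) u) = R5 d (ctxMap wf c (weakenₛ as)) (weakenₜ u)
      weakenₛ []                       = []
      weakenₛ (a ∷ as)                 = weakenₑ a ∷ weakenₛ as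

    id-args : ∀ {Γ} → 𝒥 Σ (Γ context) → Args Σ Γ (map var (OV Γ)) Γ
    id-args R1 = []
    id-args {ext Γ A _} wf@(R2 c _ _) =
      subst (λ B → 𝒥 Σ (var (fresh Γ) ∶ B ⟨ ext Γ A _ ⟩)) (sym (idₜ A (OV Γ))) (R3 wf last)
      ∷ weakenₛ wf (id-args c)

    id-map : ∀ {Γ} → 𝒥 Σ (Γ context) → CtxMap Σ Γ (map var (OV Γ)) Γ
    id-map c = ctxMap c c (id-args c)

    entry-type : ∀ {x A Γ} → 𝒥 Σ (Γ context) → x ∶ A ∈ᶜ Γ → V⟨ A ⟩ ⊆ OV Γ
    entry-type (R2 c A sc) last        = λ z → there (type-scoped A z)
    entry-type (R2 c A sc) (earlier l) = λ z → there (entry-type c l z)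

    retype : ∀ {Γ a b A B} → b ≡ a → B ≡ A → 𝒥 Σ (a ∶ A ⟨ Γ ⟩) → 𝒥 Σ (b ∶ B ⟨ Γ ⟩)
    retype refl refl d = d

    sub-var : ∀ {Δ as Γ x A} → 𝒥 Σ (Γ context) → Args Σ Δ as Γ → x ∶ A ∈ᶜ Γ →
              𝒥 Σ (x [ as / OV Γ ]ᵥ ∶ A [ as / OV Γ ]ₜ ⟨ Δ ⟩)
    sub-var {Δ} {a ∷ as} {ext Γ B _} (R2 c B-ty sc) (d ∷ ds) last =
      retype (headᵛ (fresh Γ) a as (OV Γ))
             (dropₜ a as (OV Γ) (fresh∉ Γ) B (type-scoped B-ty)) d
    sub-var {Δ} {a ∷ as} {ext Γ B _} {x} {A} (R2 c B-ty sc) (d ∷ ds) (earlier l) =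
      retype (dropᵛ a as (OV Γ) (λ { refl → fresh∉ Γ (entry∈ l) }))
             (dropₜ a as (OV Γ) (fresh∉ Γ) A (entry-type c l)) (sub-var c ds l)

    module _ {Δ : PreCtx} {bs : List PreEl} {Γ : PreCtx} where
      subₜ : ∀ {A} → CtxMap Σ Δ bs Γ → 𝒥 Σ (A type⟨ Γ ⟩) → 𝒥 Σ (A [ bs / OV Γ ]ₜ type⟨ Δ ⟩)
      subₑ : ∀ {a A} → CtxMap Σ Δ bs Γ → 𝒥 Σ (a ∶ A ⟨ Γ ⟩) →
             𝒥 Σ (a [ bs / OV Γ ]ₑ ∶ A [ bs / OV Γ ]ₜ ⟨ Δ ⟩)
      subₛ : ∀ {as Θ} → CtxMap Σ Δ bs Γ → 𝒥 Σ (Θ context) → Args Σ Γ as Θ →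
             Args Σ Δ (as [ bs / OV Γ ]ₛ) Θ
      subₜ s@(ctxMap cΔ _ _) (R4 d (ctxMap _ c as)) = R4 d (ctxMap cΔ c (subₛ s c as))
      subₑ (ctxMap _ cΓ bs) (R3 _ l) = sub-var cΓ bs l
      subₑ s@(ctxMap cΔ _ _) (R5 {Θ} {f} {U} {as = as} d (ctxMap _ c ds) u) =
        subst (λ B → 𝒥 Σ (fn f (as [ bs / OV Γ ]ₛ) ∶ B ⟨ Δ ⟩)) (sym eq)
          (R5 d (ctxMap cΔ c (subₛ s c ds)) (subst (λ B → 𝒥 Σ (B type⟨ Δ ⟩)) eq (subₜ s u)))
        where
        eq : (U [ as / OV Θ ]ₜ) [ bs / OV Γ ]ₜ ≡ U [ as [ bs / OV Γ ]ₛ / OV Θ ]ₜ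
        eq = compₜ as bs (OV Θ) (OV Γ) (args-length ds) U (scoped Σ d)
      subₛ s R1 [] = []
      subₛ s (R2 {Θ} {A} c A-ty sc) (_∷_ {a} {as} d ds) =
        subst (λ B → 𝒥 Σ (a [ bs / OV Γ ]ₑ ∶ B ⟨ Δ ⟩))
          (compₜ as bs (OV Θ) (OV Γ) (args-length ds) A (type-scoped A-ty)) (subₑ s d)
        ∷ subₛ s c ds

  module _ {Σ Σ′ : PreSignature} (Σ⊆Σ′ : decls Σ ⊆ₚ decls Σ′) where
    mono     : ∀ {j} → 𝒥 Σ j → 𝒥 Σ′ j
    monoMap  : ∀ {Δ as Γ} → CtxMap Σ Δ as Γ → CtxMap Σ′ Δ as Γ
    monoArgs : ∀ {Δ as Γ} → Args Σ Δ as Γ → Args Σ′ Δ as Γ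
    mono R1            = R1
    mono (R2 c A sc)   = R2 (mono c) (mono A) sc
    mono (R3 c l)      = R3 (mono c) l
    mono (R4 d as)     = R4 (Σ⊆Σ′ d) (monoMap as)
    mono (R5 d as u)   = R5 (Σ⊆Σ′ d) (monoMap as) (mono u)
    monoMap (ctxMap c c′ as) = ctxMap (mono c) (mono c′) (monoArgs as)
    monoArgs []        = []
    monoArgs (a ∷ as)  = mono a ∷ monoArgs as

  private
    ctx-inj : ∀ {Γ Γ′} → Γ context ≡ Γ′ context → Γ ≡ Γ′
    ctx-inj refl = refl

    ext-inj : ∀ {Γ Γ′ A A′} .{sc : V⟨ A ⟩ ⊆ OV Γ} .{sc′ : V⟨ A′ ⟩ ⊆ OV Γ′} →
              ext Γ A sc ≡ ext Γ′ A′ sc′ → Γ ≡ Γ′ × A ≡ A′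
    ext-inj refl = refl , refl

    type-inj : ∀ {A A′ Γ Γ′} → A type⟨ Γ ⟩ ≡ A′ type⟨ Γ′ ⟩ → A ≡ A′ × Γ ≡ Γ′
    type-inj refl = refl , refl

    el-inj : ∀ {a a′ A A′ Γ Γ′} → a ∶ A ⟨ Γ ⟩ ≡ a′ ∶ A′ ⟨ Γ′ ⟩ → a ≡ a′ × A ≡ A′ × Γ ≡ Γ′
    el-inj refl = refl , refl , refl

    ∷-inj : ∀ {a b : PreEl} {as bs} → a ∷ as ≡ b ∷ bs → a ≡ b × as ≡ bs
    ∷-inj refl = refl , refl

    fn-inj : ∀ {f g as bs} → fn f as ≡ fn g bs → f ≡ g × as ≡ bs
    fn-inj refl = refl , refl

    ty-inj : ∀ {S T as bs} → ty S as ≡ ty T bs → S ≡ T × as ≡ bs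
    ty-inj refl = refl , refl

    entry-uniq : ∀ {x x′ A A′ Γ Γ′} (l : x ∶ A ∈ᶜ Γ) (l′ : x′ ∶ A′ ∈ᶜ Γ′) →
                 x ≡ x′ → A ≡ A′ → Γ ≡ Γ′ → l ≅ l′
    entry-uniq last last _ refl refl = refl
    entry-uniq {Γ = ext Γ _ _} last (earlier l) refl _ refl = ⊥-elim (fresh∉ Γ (entry∈ l))
    entry-uniq {Γ = ext Γ _ _} (earlier l) last refl _ refl = ⊥-elim (fresh∉ Γ (entry∈ l))
    entry-uniq (earlier l) (earlier l′) refl refl refl with entry-uniq l l′ refl refl refl
    ... | refl = refl

  module _ {Σ : PreSignature} where
    𝒥-uniq    : ∀ {j j′} (d : 𝒥 Σ j) (d′ : 𝒥 Σ j′) → j ≡ j′ → d ≅ d′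
    map-uniq  : ∀ {Δ as Γ Δ′ as′ Γ′} (d : CtxMap Σ Δ as Γ) (d′ : CtxMap Σ Δ′ as′ Γ′) →
                Δ ≡ Δ′ → as ≡ as′ → Γ ≡ Γ′ → d ≅ d′
    args-uniq : ∀ {Δ as Γ Δ′ as′ Γ′} (d : Args Σ Δ as Γ) (d′ : Args Σ Δ′ as′ Γ′) →
                Δ ≡ Δ′ → as ≡ as′ → Γ ≡ Γ′ → d ≅ d′

    𝒥-uniq R1 R1 _ = refl
    𝒥-uniq (R2 c A _) (R2 c′ A′ _) e with ext-inj (ctx-inj e)
    ... | refl , refl with 𝒥-uniq c c′ refl | 𝒥-uniq A A′ refl
    ...   | refl | refl = refl
    𝒥-uniq (R3 c l) (R3 c′ l′) e with el-inj e
    ... | refl , refl , refl with 𝒥-uniq c c′ refl | entry-uniq l l′ refl refl refl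
    ...   | refl | refl = refl
    𝒥-uniq (R4 d as) (R4 d′ as′) e with type-inj e
    ... | e₁ , refl with ty-inj e₁
    ...   | refl , refl with ty-once Σ d d′
    ...     | refl with decls-prop Σ _ d d′ | map-uniq as as′ refl refl refl
    ...       | refl | refl = refl
    𝒥-uniq (R5 d as u) (R5 d′ as′ u′) e with el-inj e
    ... | e₁ , _ , refl with fn-inj e₁
    ...   | refl , refl with fun-once Σ d d′
    ...     | refl , refl with decls-prop Σ _ d d′ | map-uniq as as′ refl refl refl | 𝒥-uniq u u′ refl
    ...       | refl | refl | refl = refl
    𝒥-uniq R1 (R2 _ _ _) ()
    𝒥-uniq (R2 _ _ _) R1 ()
    𝒥-uniq (R3 _ _) (R5 _ _ _) e with () ← proj₁ (el-inj e)
    𝒥-uniq (R5 _ _ _) (R3 _ _) e with () ← proj₁ (el-inj e)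

    map-uniq (ctxMap c d as) (ctxMap c′ d′ as′) refl refl refl
      with 𝒥-uniq c c′ refl | 𝒥-uniq d d′ refl | args-uniq as as′ refl refl refl
    ... | refl | refl | refl = refl

    args-uniq [] [] refl _ _ = refl
    args-uniq [] (_ ∷ _) _ () _
    args-uniq (_ ∷ _) [] _ () _
    args-uniq (a ∷ as) (a′ ∷ as′) refl e e′ with ∷-inj e | ext-inj e′
    ... | refl , refl | refl , refl with 𝒥-uniq a a′ refl | args-uniq as as′ refl refl refl
    ...   | refl | refl = refl

    𝒥-prop : ∀ {j} → IsProp (𝒥 Σ j)
    𝒥-prop d d′ = ≅-to-≡ (𝒥-uniq d d′ refl)

    map-prop : ∀ {Δ as Γ} → IsProp (CtxMap Σ Δ as Γ)
    map-prop d d′ = ≅-to-≡ (map-uniq d d′ refl refl refl)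

  -- The tags in the triples (Δ,Γ,ā), the pairs (Γ,A) and ((Γ,A),a) are the
  -- indices of the corresponding record types.

  record Obj (Σ : PreSignature) : Set where
    constructor obj
    field
      {ctx} : PreCtx
      ctx-d : 𝒥 Σ (ctx context)

  open Obj

  record Mor (Σ : PreSignature) (Δ Γ : Obj Σ) : Set where
    constructor mor
    field
      {els} : List PreEl
      els-d : CtxMap Σ (ctx Δ) els (ctx Γ)

  open Mor

  record Type (Σ : PreSignature) (Γ : Obj Σ) : Set where
    constructor type
    field
      {pty} : PreTy
      pty-d : 𝒥 Σ (pty type⟨ ctx Γ ⟩)

  open Type

  record Term (Σ : PreSignature) (Γ : Obj Σ) (A : Type Σ Γ) : Set where
    constructor term
    field
      {pel} : PreEl
      pel-d : 𝒥 Σ (pel ∶ pty A ⟨ ctx Γ ⟩)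

  open Term

  module _ {Σ : PreSignature} where

    obj-≡ : {Γ Γ′ : Obj Σ} → ctx Γ ≡ ctx Γ′ → Γ ≡ Γ′
    obj-≡ {obj d} {obj d′} refl = cong obj (𝒥-prop d d′)

    mor-≡ : ∀ {Δ Γ} {f g : Mor Σ Δ Γ} → els f ≡ els g → f ≡ g
    mor-≡ {f = mor d} {mor d′} refl = cong mor (map-prop d d′)

    type-≡ : ∀ {Γ} {A B : Type Σ Γ} → pty A ≡ pty B → A ≡ B
    type-≡ {A = type d} {type d′} refl = cong type (𝒥-prop d d′)

    term-≡ : ∀ {Γ} {A : Type Σ Γ} {a b : Term Σ Γ A} → pel a ≡ pel b → a ≡ b
    term-≡ {a = term d} {term d′} refl = cong term (𝒥-prop d d′)

    term-≅ : ∀ {Γ} {A B : Type Σ Γ} {a : Term Σ Γ A} {b : Term Σ Γ B} →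
             pty A ≡ pty B → pel a ≡ pel b → a ≅ b
    term-≅ {A = A} {B} e e′ with type-≡ {A = A} {B} e
    ... | refl = ≡-to-≅ (term-≡ e′)

    pel-subst : ∀ {Γ} {A B : Type Σ Γ} (e : A ≡ B) (a : Term Σ Γ A) →
                pel (subst (Term Σ Γ) e a) ≡ pel a
    pel-subst refl a = refl

    els-args : ∀ {Δ Γ} (f : Mor Σ Δ Γ) → Args Σ (ctx Δ) (els f) (ctx Γ)
    els-args (mor (ctxMap _ _ as)) = as

    els-length : ∀ {Δ Γ} (f : Mor Σ Δ Γ) → length (els f) ≡ length (OV (ctx Γ))
    els-length f = args-length (els-args f)

    idᵐ : ∀ {Γ} → Mor Σ Γ Γ
    idᵐ {Γ} = mor (id-map (ctx-d Γ))

    infixr 9 _∘ᵐ_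
    _∘ᵐ_ : ∀ {Δ Γ Θ} → Mor Σ Γ Θ → Mor Σ Δ Γ → Mor Σ Δ Θ
    _∘ᵐ_ {Δ} {Γ} {Θ} f g =
      mor (ctxMap (ctx-d Δ) (ctx-d Θ) (subₛ (els-d g) (ctx-d Θ) (els-args f)))

    _[_]ᵗ : ∀ {Δ Γ} → Type Σ Γ → Mor Σ Δ Γ → Type Σ Δ
    A [ f ]ᵗ = type (subₜ (els-d f) (pty-d A))

    _[_]ᵉ : ∀ {Δ Γ} {A : Type Σ Γ} → Term Σ Γ A → (f : Mor Σ Δ Γ) → Term Σ Δ (A [ f ]ᵗ)
    a [ f ]ᵉ = term (subₑ (els-d f) (pel-d a))

    _▹ᵒ_ : (Γ : Obj Σ) → Type Σ Γ → Obj Σ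
    Γ ▹ᵒ A = obj (R2 (ctx-d Γ) (pty-d A) (type-scoped (pty-d A)))

    pᵐ : ∀ {Γ} (A : Type Σ Γ) → Mor Σ (Γ ▹ᵒ A) Γ
    pᵐ {Γ} A = mor (ctxMap wf (ctx-d Γ) (weakenₛ wf (id-args (ctx-d Γ))))
      where wf = ctx-d (Γ ▹ᵒ A)

    vᵉ : ∀ {Γ} (A : Type Σ Γ) → Term Σ (Γ ▹ᵒ A) (A [ pᵐ A ]ᵗ)
    vᵉ {Γ} A = term (subst (λ B → 𝒥 Σ (var (fresh (ctx Γ)) ∶ B ⟨ ctx (Γ ▹ᵒ A) ⟩))
                           (sym (idₜ (pty A) (OV (ctx Γ))))
                           (R3 (ctx-d (Γ ▹ᵒ A)) last))

    pairᵐ : ∀ {Δ Γ} (A : Type Σ Γ) (f : Mor Σ Δ Γ) → Term Σ Δ (A [ f ]ᵗ) → Mor Σ Δ (Γ ▹ᵒ A)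
    pairᵐ {Δ} {Γ} A f b = mor (ctxMap (ctx-d Δ) (ctx-d (Γ ▹ᵒ A)) (pel-d b ∷ els-args f))

    []ᵗ-∘ : ∀ {Ξ Δ Γ} (A : Type Σ Γ) (f : Mor Σ Δ Γ) (g : Mor Σ Ξ Δ) →
            A [ f ∘ᵐ g ]ᵗ ≡ A [ f ]ᵗ [ g ]ᵗ
    []ᵗ-∘ A f g = type-≡ (sym (compₜ (els f) (els g) _ _ (els-length f) (pty A)
                                     (type-scoped (pty-d A))))

    []ᵉ-∘ : ∀ {Ξ Δ Γ} {A : Type Σ Γ} (a : Term Σ Γ A) (f : Mor Σ Δ Γ) (g : Mor Σ Ξ Δ) →
            a [ f ∘ᵐ g ]ᵉ ≅ a [ f ]ᵉ [ g ]ᵉ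
    []ᵉ-∘ {A = A} a f g =
      term-≅ (cong pty ([]ᵗ-∘ A f g))
             (sym (compₑ (els f) (els g) _ _ (els-length f) (pel a) (el-scoped (pel-d a))))

    pᵐ-∘ : ∀ {Γ} (A : Type Σ Γ) a as → length as ≡ length (OV (ctx Γ)) →
           els (pᵐ A) [ a ∷ as / OV (ctx (Γ ▹ᵒ A)) ]ₛ ≡ as
    pᵐ-∘ {Γ = Γ} A a as e =
      trans (dropₛ a as xs (fresh∉ (ctx Γ)) (map var xs) (vars-scoped xs))
            (vars-inst {ctx Γ} as e)
      where xs = OV (ctx Γ)

  ℱ : Signature → Cwf 0ℓ 0ℓ 0ℓ 0ℓ
  ℱ Sig = record
    { Ob        = Obj Σ
    ; Hom       = Mor Σ
    ; id        = idᵐ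
    ; _∘_       = _∘ᵐ_
    ; identityˡ = λ {_} {Γ} f → mor-≡ (vars-inst {ctx Γ} (els f) (els-length f))
    ; identityʳ = λ f → mor-≡ (idₛ (els f) _)
    ; assoc     = λ f g h → mor-≡ (compₛ (els g) (els h) _ _ (els-length g) (els f)
                                         (args-scoped (els-args f)))
    ; ⊤         = obj R1
    ; !         = λ {Γ} → mor (ctxMap (ctx-d Γ) R1 [])
    ; !-unique  = λ { (mor (ctxMap _ _ [])) → mor-≡ refl }
    ; Ty        = Type Σ
    ; _[_]      = _[_]ᵗ
    ; [id]      = λ A → type-≡ (idₜ (pty A) _)
    ; [∘]       = []ᵗ-∘
    ; _▹_       = _▹ᵒ_
    ; p         = pᵐ
    ; Tm        = Term Σ
    ; _[_]ₜ     = _[_]ᵉ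
    ; [id]ₜ     = λ {_} {A} a → term-≅ (idₜ (pty A) _) (idₑ (pel a) _)
    ; [∘]ₜ      = []ᵉ-∘
    ; v         = vᵉ
    ; ⟨_∣_,_⟩   = pairᵐ
    ; p-⟨⟩      = λ A f a → mor-≡ (p-pair A f a)
    ; v-⟨⟩      = λ {_} {Γ} A f a →
        term-≅ (trans (compₜ _ _ _ _ (els-length (pᵐ A)) (pty A) (type-scoped (pty-d A)))
                      (cong (λ as → pty A [ as / OV (ctx Γ) ]ₜ) (p-pair A f a)))
               (headᵛ (fresh (ctx Γ)) (pel a) (els f) (OV (ctx Γ)))
    ; ⟨⟩-η      = λ { {_} {Γ} A h@(mor {els = b ∷ bs} (ctxMap c d (b-d ∷ bs-d))) →
        mor-≡ (cong₂ _∷_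
                 (trans (pel-subst (sym ([]ᵗ-∘ A (pᵐ A) h)) (vᵉ A [ h ]ᵉ))
                        (headᵛ (fresh (ctx Γ)) b bs (OV (ctx Γ))))
                 (pᵐ-∘ {Γ = Γ} A b bs (args-length bs-d))) }
    ; ⟨⟩-∘      = λ A f a g → mor-≡ (cong (_∷ _) (sym (pel-subst (sym ([]ᵗ-∘ A f g)) (a [ g ]ᵉ))))
    }
    where
    Σ = preSig Sig
    p-pair : ∀ {Δ Γ} (A : Type Σ Γ) (f : Mor Σ Δ Γ) (a : Term Σ Δ (A [ f ]ᵗ)) →
             els (pᵐ A ∘ᵐ pairᵐ A f a) ≡ els f
    p-pair {Γ = Γ} A f a = pᵐ-∘ {Γ = Γ} A (pel a) (els f) (els-length f)

  Embed : (Sig Sig′ : Signature) → decls (preSig Sig) ⊆ₚ decls (preSig Sig′) →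
          CwfMor (ℱ Sig) (ℱ Sig′)
  Embed Sig Sig′ Σ⊆Σ′ = record
    { F₀   = E₀
    ; F₁   = E₁
    ; F-id = mor-≡ refl
    ; F-∘  = λ f g → mor-≡ refl
    ; F-⊤  = refl
    ; σ    = E-Ty
    ; σ-[] = E-[]
    ; F-▹  = λ A → refl
    ; F-p  = λ A → ≡-to-≅ (mor-≡ refl)
    ; θ    = E-Tm
    ; θ-[] = λ a f → term-≅ refl refl
    ; θ-v  = λ A → term-≅ refl refl
    ; F-⟨⟩ = λ A f a → ≡-to-≅ (mor-≡ (cong (_∷ _) (sym (pel-subst (E-[] A f) (E-Tm a)))))
    }
    where
    Σ  = preSig Sig
    Σ′ = preSig Sig′
    E₀ : Obj Σ → Obj Σ′
    E₀ Γ = obj (mono {Σ} {Σ′} Σ⊆Σ′ (ctx-d Γ))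
    E₁ : ∀ {Δ Γ} → Mor Σ Δ Γ → Mor Σ′ (E₀ Δ) (E₀ Γ)
    E₁ f = mor (monoMap {Σ} {Σ′} Σ⊆Σ′ (els-d f))
    E-Ty : ∀ {Γ} → Type Σ Γ → Type Σ′ (E₀ Γ)
    E-Ty A = type (mono {Σ} {Σ′} Σ⊆Σ′ (pty-d A))
    E-Tm : ∀ {Γ} {A : Type Σ Γ} → Term Σ Γ A → Term Σ′ (E₀ Γ) (E-Ty A)
    E-Tm a = term (mono {Σ} {Σ′} Σ⊆Σ′ (pel-d a))
    E-[] : ∀ {Δ Γ} (A : Type Σ Γ) (f : Mor Σ Δ Γ) → E-Ty (A [ f ]ᵗ) ≡ E-Ty A [ E₁ f ]ᵗ
    E-[] A f = type-≡ refl

  Undeclared : TySym → PreSignature → Set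
  Undeclared S Σ = ∀ Γ → ¬ (tyDecl Γ S ∈ₚ decls Σ)

  module Extend (Sig : Signature) (S : TySym) (S∉Σ : Undeclared S (preSig Sig))
                (Γₛ : PreCtx) (Γₛ-d : 𝒥 (preSig Sig) (Γₛ context)) where
    private
      Σ = preSig Sig
      module Σ = Signature Sig

      declared≢ : ∀ {d} → d ∈ₚ decls Σ → tyDecl Γₛ S ≢ d
      declared≢ d∈ refl = S∉Σ Γₛ d∈

    Σ′ : PreSignature
    Σ′ = record
      { decls      = decls Σ ∪ ｛ tyDecl Γₛ S ｝
      ; decls-prop = λ
          { d (inj₁ p) (inj₁ q) → cong inj₁ (decls-prop Σ d p q)
          ; d (inj₁ p) (inj₂ q) → contradiction q (declared≢ p)
          ; d (inj₂ p) (inj₁ q) → contradiction p (declared≢ q)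
          ; d (inj₂ refl) (inj₂ refl) → refl }
      ; scoped     = λ { (inj₁ p) → scoped Σ p }
      ; ty-once    = λ
          { (inj₁ p) (inj₁ q) → ty-once Σ p q
          ; (inj₁ p) (inj₂ refl) → ⊥-elim (S∉Σ _ p)
          ; (inj₂ refl) (inj₁ q) → ⊥-elim (S∉Σ _ q)
          ; (inj₂ refl) (inj₂ refl) → refl }
      ; fun-once   = λ { (inj₁ p) (inj₁ q) → fun-once Σ p q }
      }

    Σ⊆Σ′ : decls Σ ⊆ₚ decls Σ′
    Σ⊆Σ′ = inj₁

    Sig′ : Signature
    Sig′ = record
      { preSig = Σ′
      ; isSig  = record
          { ty-ok  = λ { (inj₁ p) → mono {Σ} {Σ′} Σ⊆Σ′ (Σ.ty-ok p)
                       ; (inj₂ refl) → mono {Σ} {Σ′} Σ⊆Σ′ Γₛ-d }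
          ; fun-ok = λ { (inj₁ p) → mono {Σ} {Σ′} Σ⊆Σ′ (Σ.fun-ok p) }
          }
      }

    E : CwfMor (ℱ Sig) (ℱ Sig′)
    E = Embed Sig Sig′ Σ⊆Σ′

    ⟦Γₛ⟧ : Obj Σ
    ⟦Γₛ⟧ = obj Γₛ-d

    -- S(OV(Γₛ)) as a type of ℱ Sig′ over Γₛ.
    S-generic : Type Σ′ (CwfMor.F₀ E ⟦Γₛ⟧)
    S-generic = type (R4 (inj₂ refl) (id-map (mono {Σ} {Σ′} Σ⊆Σ′ Γₛ-d)))

{-# OPTIONS --safe #-}
module Submission where

open import Defs
open import Level using (Level; _⊔_)
open import Data.List.Base using (List; []; _∷_; length; map)
open import Data.List.Membership.Propositional using (_∈_)
open import Data.List.Relation.Binary.Subset.Propositional using (_⊆_)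
open import Data.List.Relation.Unary.Any using (here; there)
open import Data.Maybe.Base as Maybe using (Maybe; just; nothing)
open import Data.Maybe.Properties using (just-injective)
open import Data.Nat.Base using (suc)
open import Data.Nat.Properties using (_≟_)
open import Data.Product using (_×_; _,_; proj₁; proj₂; ∃; ∃!)
open import Data.Sum.Base using (inj₁; inj₂)
open import Relation.Binary.HeterogeneousEquality
  using (_≅_; refl; ≡-to-≅; ≡-subst-removable)
  renaming (sym to ≅-sym; trans to ≅-trans)
open import Relation.Binary.PropositionalEquality
  using (_≡_; _≢_; refl; sym; trans; cong; subst)
open import Relation.Nullary using (yes; no; contradiction)
open import Relation.Unary using () renaming (_⊆_ to _⊆ₚ_; _∈_ to _∈ₚ_)

-- The syntax is interpreted in C by a relation between raw expressions and
-- their values, generated by the declarations, so that it needs no well-typed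
-- input.  The values of the variables of a context are jointly monic, which
-- makes the relation functional; it is stable under substitution, and from this
-- it is total on derivable judgements, where it yields a cwf morphism.
-- Conversely, any cwf morphism that takes the declared symbols to the values
-- assigned to them satisfies the relation, and two morphisms that satisfy it are
-- equal.  For Σ′ the old symbols get their values from G and S gets A.  Applied
-- to G, the converse interprets all declared contexts, which gives existence
-- and G′ ∘ E = G; applied to a competitor of G′, it gives uniqueness.

-- Values, environments and worlds in a cwf.

module Worlds {o h t m : Level} (C : Cwf o h t m) where
  private module C = Cwf C

  -- Pairing a term with its type lets terms whose types agree only propositionally be compared by
  -- `_≡_`.
  Value : C.Ob → Set (t ⊔ m)
  Value X = ∃ λ (A : C.Ty X) → C.Tm X A

  value-≡ : ∀ {X} {A B : C.Ty X} {a : C.Tm X A} {b : C.Tm X B} →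
            A ≡ B → a ≅ b → _≡_ {A = Value X} (A , a) (B , b)
  value-≡ refl refl = refl

  tm-≅ : ∀ {X} {v w : Value X} → v ≡ w → proj₂ v ≅ proj₂ w
  tm-≅ refl = refl

  infixl 8 _⟦_⟧
  _⟦_⟧ : ∀ {X Y} → Value X → C.Hom Y X → Value Y
  (A , a) ⟦ f ⟧ = A C.[ f ] , a C.[ f ]ₜ

  ⟦id⟧ : ∀ {X} (w : Value X) → w ⟦ C.id ⟧ ≡ w
  ⟦id⟧ (A , a) = value-≡ (C.[id] A) (C.[id]ₜ a)

  ⟦∘⟧ : ∀ {X Y Z} (w : Value X) (f : C.Hom Y X) (g : C.Hom Z Y) →
        w ⟦ f C.∘ g ⟧ ≡ w ⟦ f ⟧ ⟦ g ⟧
  ⟦∘⟧ (A , a) f g = value-≡ (C.[∘] A f g) (C.[∘]ₜ a f g)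

  Env : C.Ob → Set (t ⊔ m)
  Env X = V → Maybe (Value X)

  World : Set (o ⊔ t ⊔ m)
  World = ∃ Env

  -- `q` and `u` are left general because `Canonical.env` extends along the images of a projection
  -- and a generic term under a cwf morphism, which agree with those of `C` only heterogeneously.
  extend : ∀ {X Y} → C.Hom Y X → Value Y → V → Env X → Env Y
  extend q u n ρ x with x ≟ n
  ... | yes _ = just u
  ... | no  _ = Maybe.map (_⟦ q ⟧) (ρ x)

  var₀ : ∀ {X} (A : C.Ty X) → Value (X C.▹ A)
  var₀ A = A C.[ C.p A ] , C.v A

  cons : V → (W : World) → C.Ty (proj₁ W) → World
  cons n (X , ρ) A = X C.▹ A , extend (C.p A) (var₀ A) n ρ

  extend-head : ∀ {X Y} (q : C.Hom Y X) (u : Value Y) n (ρ : Env X) → extend q u n ρ n ≡ just u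
  extend-head q u n ρ with n ≟ n
  ... | yes _  = refl
  ... | no n≢n = contradiction refl n≢n

  extend-tail : ∀ {X Y} (q : C.Hom Y X) (u : Value Y) {n x} (ρ : Env X) {w} → x ≢ n →
                ρ x ≡ just w → extend q u n ρ x ≡ just (w ⟦ q ⟧)
  extend-tail q u {n} {x} ρ x≢n e with x ≟ n
  ... | yes x≡n = contradiction x≡n x≢n
  ... | no _    = cong (Maybe.map (_⟦ q ⟧)) e

  map-just : ∀ {X Y} (q : C.Hom Y X) (r : Maybe (Value X)) {w} →
             Maybe.map (_⟦ q ⟧) r ≡ just w → ∃ λ w′ → r ≡ just w′ × w′ ⟦ q ⟧ ≡ w
  map-just q (just w′) refl = w′ , refl , refl

  extend-≡ : ∀ {X X′} {ρ : Env X} {ρ′ : Env X′} {Y Y′ q q′}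
               {A : C.Ty Y} {A′ : C.Ty Y′} {a : C.Tm Y A} {a′ : C.Tm Y′ A′} n →
             _≡_ {A = World} (X , ρ) (X′ , ρ′) → Y ≡ Y′ → q ≅ q′ → A ≅ A′ → a ≅ a′ →
             _≡_ {A = World} (Y , extend q (A , a) n ρ) (Y′ , extend q′ (A′ , a′) n ρ′)
  extend-≡ n refl refl refl refl refl = refl

  ⟨⟩-ext : ∀ {X Y} {A : C.Ty X} (f g : C.Hom Y (X C.▹ A)) → C.p A C.∘ f ≡ C.p A C.∘ g →
           var₀ A ⟦ f ⟧ ≡ var₀ A ⟦ g ⟧ → f ≡ g
  ⟨⟩-ext {A = A} f g e e′ =
    trans (sym (C.⟨⟩-η A f)) (trans (⟨⟩-cong e
      (≅-trans (≡-subst-removable (C.Tm _) _ _)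
      (≅-trans (tm-≅ e′) (≅-sym (≡-subst-removable (C.Tm _) _ _))))) (C.⟨⟩-η A g))
    where open Cwf-cong C

-- Assignments, generic instances and the worlds of a given morphism.

module Interpretation (TySym FunSym : Set) {o h t m : Level} (C : Cwf o h t m) where
  open Syntax TySym FunSym
  open PreSignature
  open Obj
  open Mor
  open Type
  open Term
  open Worlds C public
  private module C = Cwf C

  -- The world assigned to a declaration is meant as the value of its context;
  -- this is only imposed in Functional below, where values are already defined.
  record Assignment (Θ : PreSignature) : Set (o ⊔ t ⊔ m) where
    field
      ty-val  : ∀ {Γ S} → tyDecl Γ S ∈ₚ decls Θ → ∃ λ (W : World) → C.Ty (proj₁ W)
      fun-val : ∀ {Γ f U} → funDecl Γ f U ∈ₚ decls Θ → ∃ λ (W : World) → Value (proj₁ W)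

  []ₛ-length : ∀ as bs ys → length (as [ bs / ys ]ₛ) ≡ length as
  []ₛ-length []       bs ys = refl
  []ₛ-length (a ∷ as) bs ys = cong suc ([]ₛ-length as bs ys)

  type-ctx : ∀ {Φ A Γ} → 𝒥 Φ (A type⟨ Γ ⟩) → 𝒥 Φ (Γ context)
  type-ctx (R4 _ (ctxMap c _ _)) = c

  entry-type-d : ∀ {Φ Γ x A} → 𝒥 Φ (Γ context) → x ∶ A ∈ᶜ Γ → 𝒥 Φ (A type⟨ Γ ⟩)
  entry-type-d wf@(R2 c A _) last        = weakenₜ wf A
  entry-type-d wf@(R2 c _ _) (earlier l) = weakenₜ wf (entry-type-d c l)

  module Generic (Sig : Signature) where
    open Signature Sig using (preSig; ty-ok; fun-ok)

    generic-ty : ∀ {Γ S} (d : tyDecl Γ S ∈ₚ decls preSig) → Type preSig (obj (ty-ok d))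
    generic-ty d = type (R4 d (id-map (ty-ok d)))

    -- Rule `R5` types the generic element by `U` with the variables of `Γ` substituted for
    -- themselves, which equals `U` only propositionally.
    codomain : ∀ {Γ f U} → funDecl Γ f U ∈ₚ decls preSig → (c : 𝒥 preSig (Γ context)) →
               Type preSig (obj c)
    codomain {Γ} {U = U} d c =
      type (subst (λ B → 𝒥 preSig (B type⟨ Γ ⟩)) (sym (idₜ U (OV Γ))) (fun-ok d))

    generic-el : ∀ {Γ f U} (d : funDecl Γ f U ∈ₚ decls preSig) (c : 𝒥 preSig (Γ context)) →
                 Term preSig (obj c) (codomain d c)
    generic-el d c = term (R5 d (id-map c) (pty-d (codomain d c)))

  module Canonical {Sig : Signature} (H : CwfMor (ℱ Sig) C) where
    open CwfMor H
    open CwfMor-cong H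
    private Φ = Signature.preSig Sig

    value : ∀ {Γ} {A : Type Φ Γ} → Term Φ Γ A → Value (F₀ Γ)
    value {A = A} a = σ A , θ a

    value-cong : ∀ {Γ} {A B : Type Φ Γ} {a : Term Φ Γ A} {b : Term Φ Γ B} →
                 pty A ≡ pty B → pel a ≡ pel b → value a ≡ value b
    value-cong e e′ =
      value-≡ (cong σ (type-≡ e)) (θ-cong refl (≡-to-≅ (type-≡ e)) (term-≅ e e′))

    value-[] : ∀ {Δ Γ} {A : Type Φ Γ} (a : Term Φ Γ A) (f : Mor Φ Δ Γ) →
               value (a [ f ]ᵉ) ≡ value a ⟦ F₁ f ⟧
    value-[] {A = A} a f = value-≡ (σ-[] A f) (θ-[] a f)

    env : ∀ {Γ} (c : 𝒥 Φ (Γ context)) → Env (F₀ (obj c))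
    env R1                 x = nothing
    env (R2 {Γ} {A} c A-d _) = extend (F₁ (pᵐ 𝐀)) (value (vᵉ 𝐀)) (fresh Γ) (env c)
      where
      𝐀 : Type Φ (obj c)
      𝐀 = type A-d

    world : ∀ {Γ} → 𝒥 Φ (Γ context) → World
    world c = F₀ (obj c) , env c

    -- Reindexing a variable along the projection leaves its name unchanged, so `value-[]` carries
    -- its value into each further extension.
    env-entry : ∀ {Γ x A} (c : 𝒥 Φ (Γ context)) (l : x ∶ A ∈ᶜ Γ) (A-d : 𝒥 Φ (A type⟨ Γ ⟩)) →
                env c x ≡ just (value (term {A = type {Γ = obj c} A-d} (R3 c l)))
    env-entry (R2 {Γ} {A} c A-d _) last _ =
      trans (extend-head (F₁ (pᵐ {Γ = obj c} (type A-d))) _ (fresh Γ) (env c))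
            (cong just (value-cong (idₜ A (OV Γ)) refl))
    env-entry {x = x} {A} (R2 {Γ} c B-d _) (earlier l) _ =
      trans (extend-tail (F₁ p) _ (env c) (λ { refl → fresh∉ Γ (entry∈ l) }) (env-entry c l A-d))
            (cong just (trans (sym (value-[] x-el p))
                              (value-cong (idₜ A (OV Γ)) (idᵛ x (OV Γ)))))
      where
      A-d = entry-type-d c l
      p = pᵐ {Γ = obj c} (type B-d)
      x-el : Term Φ (obj c) (type A-d)
      x-el = term (R3 c l)

  -- The evaluation relation.

  module Relation (Sig₀ : Signature) (M : Assignment (Signature.preSig Sig₀)) where
    open Assignment M
    private Θ = Signature.preSig Sig₀

    infix 4 _⊢_⇓ᵗ_ _⊢_⇓ᵉ_
    -- A symbol has a value only at its generic instance; any other instance reindexes it along a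
    -- realizer of the arguments. The length equation is what `compᵛ` requires for stability under
    -- substitution.
    data _⊢_⇓ᵗ_ {X : C.Ob} (ρ : Env X) : PreTy → C.Ty X → Set (o ⊔ h ⊔ t ⊔ m)
    data _⊢_⇓ᵉ_ {X : C.Ob} (ρ : Env X) : PreEl → Value X → Set (o ⊔ h ⊔ t ⊔ m)
    -- The morphism is the semantic counterpart of the raw substitution. Quantifying over the
    -- variables that have a value, instead of recursing on the lists, makes identities and
    -- projections realizers without induction on contexts.
    Realizes : ∀ {X} → Env X → List PreEl → List V → (W : World) → C.Hom X (proj₁ W) →
               Set (o ⊔ h ⊔ t ⊔ m)

    data _⊢_⇓ᵗ_ {X} ρ where
      ty : ∀ {Γ S as} (d : tyDecl Γ S ∈ₚ decls Θ) (f : C.Hom X (proj₁ (proj₁ (ty-val d)))) →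
           length as ≡ length (OV Γ) → Realizes ρ as (OV Γ) (proj₁ (ty-val d)) f →
           ρ ⊢ ty S as ⇓ᵗ proj₂ (ty-val d) C.[ f ]

    data _⊢_⇓ᵉ_ {X} ρ where
      var : ∀ {x w} → ρ x ≡ just w → ρ ⊢ var x ⇓ᵉ w
      fn  : ∀ {Γ g U as} (d : funDecl Γ g U ∈ₚ decls Θ) (f : C.Hom X (proj₁ (proj₁ (fun-val d)))) →
            length as ≡ length (OV Γ) → Realizes ρ as (OV Γ) (proj₁ (fun-val d)) f →
            ρ ⊢ fn g as ⇓ᵉ proj₂ (fun-val d) ⟦ f ⟧

    Realizes ρ as xs (Y , ν) f = ∀ x {w} → ν x ≡ just w → ρ ⊢ x [ as / xs ]ᵥ ⇓ᵉ w ⟦ f ⟧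

    data _⇓ᶜ_ : PreCtx → World → Set (o ⊔ h ⊔ t ⊔ m) where
      ⟨⟩  : ⟨⟩ ⇓ᶜ (C.⊤ , λ _ → nothing)
      ext : ∀ {Γ A W 𝐀} .{sc : V⟨ A ⟩ ⊆ OV Γ} → Γ ⇓ᶜ W → proj₂ W ⊢ A ⇓ᵗ 𝐀 → ext Γ A sc ⇓ᶜ cons (fresh Γ) W 𝐀

    retarget : ∀ {X} {ρ : Env X} {a b v w} → a ≡ b → v ≡ w → ρ ⊢ a ⇓ᵉ v → ρ ⊢ b ⇓ᵉ w
    retarget refl refl d = d

    retargetᵗ : ∀ {X} {ρ : Env X} {A B 𝐀 𝐁} → A ≡ B → 𝐀 ≡ 𝐁 → ρ ⊢ A ⇓ᵗ 𝐀 → ρ ⊢ B ⇓ᵗ 𝐁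
    retargetᵗ refl refl d = d

    env-dom : ∀ {Γ W x w} → Γ ⇓ᶜ W → proj₂ W x ≡ just w → x ∈ OV Γ
    env-dom {x = x} (ext {Γ} {W = W} {𝐀} c _) e with x ≟ fresh Γ
    ... | yes x≡ = here x≡
    ... | no _ with map-just (C.p 𝐀) (proj₂ W x) e
    ...   | _ , e′ , _ = there (env-dom c e′)

    env-fresh : ∀ {Γ W x w} → Γ ⇓ᶜ W → proj₂ W x ≡ just w → x ≢ fresh Γ
    env-fresh {Γ} c e refl = fresh∉ Γ (env-dom c e)

    -- Induction on the context, from uniqueness of maps into the terminal object and `⟨⟩-ext`. The
    -- composites with the projection are tested on the earlier variables, whose values in the
    -- extension are reindexed along it.
    separating : ∀ {Γ W X} → Γ ⇓ᶜ W → (f g : C.Hom X (proj₁ W)) →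
                 (∀ x {w} → proj₂ W x ≡ just w → w ⟦ f ⟧ ≡ w ⟦ g ⟧) → f ≡ g
    separating ⟨⟩ f g _ = trans (C.!-unique f) (sym (C.!-unique g))
    separating (ext {Γ} {W = X , ρ} {𝐀} c _) f g e =
      ⟨⟩-ext f g
        (separating c _ _ λ x {w} e′ →
          trans (⟦∘⟧ w (C.p 𝐀) f)
            (trans (e x (extend-tail (C.p 𝐀) (var₀ 𝐀) ρ (env-fresh c e′) e′))
                   (sym (⟦∘⟧ w (C.p 𝐀) g))))
        (e (fresh Γ) (extend-head (C.p 𝐀) (var₀ 𝐀) (fresh Γ) ρ))

    realizes-cons : ∀ {Γ W X} {ρ : Env X} {as 𝐀 a} (f : C.Hom X (proj₁ W))
                    (u : C.Tm X (𝐀 C.[ f ])) → Γ ⇓ᶜ W → Realizes ρ as (OV Γ) W f →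
                    ρ ⊢ a ⇓ᵉ (𝐀 C.[ f ] , u) →
                    Realizes ρ (a ∷ as) (fresh Γ ∷ OV Γ) (cons (fresh Γ) W 𝐀) C.⟨ 𝐀 ∣ f , u ⟩
    realizes-cons {Γ} {W} {𝐀 = 𝐀} f u c r a⇓ x e with x ≟ fresh Γ
    realizes-cons {𝐀 = 𝐀} f u c r a⇓ _ refl | yes _ =
      retarget refl
        (sym (value-≡ (trans (sym (C.[∘] 𝐀 (C.p 𝐀) _)) (cong (𝐀 C.[_]) (C.p-⟨⟩ 𝐀 f u)))
                 (C.v-⟨⟩ 𝐀 f u))) a⇓
    ... | no _ with map-just (C.p 𝐀) (proj₂ W x) e
    ...   | w′ , e′ , refl =
      retarget refl (trans (cong (w′ ⟦_⟧) (sym (C.p-⟨⟩ 𝐀 f u))) (⟦∘⟧ w′ (C.p 𝐀) _)) (r x e′)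

    record Sound {Sig : Signature} (H : CwfMor (ℱ Sig) C) : Set (o ⊔ h ⊔ t ⊔ m) where
      open CwfMor H
      private Φ = Signature.preSig Sig
      field
        env  : (Γ : Obj Φ) → Env (F₀ Γ)
        ctx⇓ : (Γ : Obj Φ) → ctx Γ ⇓ᶜ (F₀ Γ , env Γ)
        ty⇓  : ∀ {Γ} (A : Type Φ Γ) → env Γ ⊢ pty A ⇓ᵗ σ A
        el⇓  : ∀ {Γ} {A : Type Φ Γ} (a : Term Φ Γ A) → env Γ ⊢ pel a ⇓ᵉ (σ A , θ a)
        hom⇓ : ∀ {Δ Γ} (f : Mor Φ Δ Γ) →
               Realizes (env Δ) (els f) (OV (ctx Γ)) (F₀ Γ , env Γ) (F₁ f)

    -- The embedding changes derivations but no raw expression, so the evaluations for `H` serve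
    -- unchanged.
    sound-∘ : ∀ {Sig Sig′} (i : decls (Signature.preSig Sig) ⊆ₚ decls (Signature.preSig Sig′))
              {H : CwfMor (ℱ Sig′) C} → Sound H → Sound (H ∘ᶜ Embed Sig Sig′ i)
    sound-∘ {Sig} {Sig′} i s = record
      { env  = λ Γ → env (E.F₀ Γ)
      ; ctx⇓ = λ Γ → ctx⇓ (E.F₀ Γ)
      ; ty⇓  = λ A → ty⇓ (E.σ A)
      ; el⇓  = λ a → el⇓ (E.θ a)
      ; hom⇓ = λ f → hom⇓ (E.F₁ f)
      }
      where
      open Sound s
      module E = CwfMor (Embed Sig Sig′ i)

    -- The index of `ty` is computed from `ty-val d`; a known value of it is matched here once.
    ty-via : ∀ {Γ S as X} {ρ : Env X} (d : tyDecl Γ S ∈ₚ decls Θ) {W 𝐀} →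
             ty-val d ≡ (W , 𝐀) → (f : C.Hom X (proj₁ W)) → length as ≡ length (OV Γ) →
             Realizes ρ as (OV Γ) W f → ρ ⊢ ty S as ⇓ᵗ 𝐀 C.[ f ]
    ty-via d refl = ty d

    fn-via : ∀ {Γ g U as X} {ρ : Env X} (d : funDecl Γ g U ∈ₚ decls Θ) {W w} →
             fun-val d ≡ (W , w) → (f : C.Hom X (proj₁ W)) → length as ≡ length (OV Γ) →
             Realizes ρ as (OV Γ) W f → ρ ⊢ fn g as ⇓ᵉ w ⟦ f ⟧
    fn-via d refl = fn d

    ⟨⟩-via : ∀ {X} → X ≡ C.⊤ → ⟨⟩ ⇓ᶜ (X , λ _ → nothing)
    ⟨⟩-via refl = ⟨⟩

    -- Soundness of morphisms that agree with the assignment.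

    module Coherence
      {Sig : Signature} (H : CwfMor (ℱ Sig) C)
      (i : decls (Signature.preSig Sig) ⊆ₚ decls Θ)
      (ty-gen : ∀ {Γ S} (d : tyDecl Γ S ∈ₚ decls (Signature.preSig Sig)) →
                ty-val (i d) ≡ (Canonical.world H (Signature.ty-ok Sig d) ,
                                CwfMor.σ H (Generic.generic-ty Sig d)))
      -- A signature derives the codomain of a function symbol, not directly its context, so the
      -- derivation of the context is left to be chosen.
      (fun-gen : ∀ {Γ f U} (d : funDecl Γ f U ∈ₚ decls (Signature.preSig Sig)) →
                 ∃ λ c → fun-val (i d) ≡ (Canonical.world H c ,
                                          Canonical.value H (Generic.generic-el Sig d c)))
      where
      open CwfMor H
      open Canonical H
      open Generic Sig
      open Signature Sig using (ty-ok)
      private Φ = Signature.preSig Sig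

      -- Every instance is the generic one reindexed along its arguments, so naturality of `σ` and
      -- `θ` reduces it to an assigned value. The recursion descends along the last derivation; the
      -- type of an element is derived separately because for arguments it comes from `subₜ` and is
      -- no subderivation.
      ty-coherent   : ∀ {Γ A} (c : 𝒥 Φ (Γ context)) (A-d : 𝒥 Φ (A type⟨ Γ ⟩)) →
                      env c ⊢ A ⇓ᵗ σ {Γ = obj c} (type A-d)
      el-coherent   : ∀ {Γ a A} (c : 𝒥 Φ (Γ context)) (A-d : 𝒥 Φ (A type⟨ Γ ⟩))
                      (a-d : 𝒥 Φ (a ∶ A ⟨ Γ ⟩)) →
                      env c ⊢ a ⇓ᵉ value (term {Γ = obj c} {A = type A-d} a-d)
      args-coherent : ∀ {Δ as Γ} (c : 𝒥 Φ (Δ context)) (c′ : 𝒥 Φ (Γ context))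
                      (as-d : Args Φ Δ as Γ) →
                      Realizes (env c) as (OV Γ) (world c′) (F₁ (mor (ctxMap c c′ as-d)))
      ty-coherent c (R4 {Γ} {S} {as = as} d (ctxMap _ _ as-d)) =
        retargetᵗ refl
          (trans (sym (σ-[] (generic-ty d) f))
                 (cong σ (type-≡ (cong (ty S) (vars-inst {Γ} as (args-length as-d))))))
          (ty-via (i d) (ty-gen d) (F₁ f) (args-length as-d) (args-coherent c (ty-ok d) as-d))
        where f = mor (ctxMap c (ty-ok d) as-d)
      el-coherent c A-d (R3 _ l) =
        var (trans (env-entry c l A-d) (cong just (value-cong refl refl)))
      el-coherent c A-d (R5 {Γ} {g} {U} {as = as} d (ctxMap _ _ as-d) _) =
        retarget refl
          (trans (sym (value-[] (generic-el d c′) f))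
                 (value-cong (cong (_[ as / OV Γ ]ₜ) (idₜ U (OV Γ)))
                             (cong (fn g) (vars-inst {Γ} as (args-length as-d)))))
          (fn-via (i d) (proj₂ (fun-gen d)) (F₁ f) (args-length as-d) (args-coherent c c′ as-d))
        where
        c′ = proj₁ (fun-gen d)
        f = mor (ctxMap c c′ as-d)
      args-coherent c R1 [] x ()
      args-coherent {as = a ∷ as} c wf@(R2 {Γ} {A} c′ A-d _) (a-d ∷ as-d) x e with x ≟ fresh Γ
      args-coherent {as = a ∷ as} c wf@(R2 {Γ} {A} c′ A-d _) (a-d ∷ as-d) x refl | yes _ =
        retarget refl
          (trans (value-cong (sym (trans (cong (_[ a ∷ as / fresh Γ ∷ OV Γ ]ₜ) (idₜ A (OV Γ)))
                                         (dropₜ a as (OV Γ) (fresh∉ Γ) A (type-scoped A-d))))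
                             (sym (headᵛ (fresh Γ) a as (OV Γ))))
                 (value-[] (vᵉ {Γ = obj c′} (type A-d)) (mor (ctxMap c wf (a-d ∷ as-d)))))
          (el-coherent c (subₜ (ctxMap c c′ as-d) A-d) a-d)
      ... | no _ with map-just (F₁ (pᵐ {Γ = obj c′} (type A-d))) (env c′ x) e
      ...   | w , e′ , refl =
        -- Projecting `a ∷ as` gives back `as`, so reindexing along the image of the projection and
        -- then along `F₁ f` is reindexing along the image of `as`.
        retarget refl
          (trans (cong (w ⟦_⟧) (trans (cong F₁ (mor-≡ (sym (pᵐ-∘ {Γ = obj c′} (type A-d) a as
                                                              (args-length as-d)))))
                                      (F-∘ (pᵐ (type A-d)) f)))
                 (⟦∘⟧ w (F₁ (pᵐ (type A-d))) (F₁ f)))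
          (args-coherent c c′ as-d x e′)
        where
        f : Mor Φ (obj c) (obj c′ ▹ᵒ type A-d)
        f = mor (ctxMap c wf (a-d ∷ as-d))

      -- `cons` uses the projection and generic term of `C`, `env` the images of the syntactic ones;
      -- `extend-≡` identifies the two worlds because `H` preserves both.
      ctx-coherent : ∀ {Γ} (c : 𝒥 Φ (Γ context)) → Γ ⇓ᶜ world c
      ctx-coherent R1 = ⟨⟩-via F-⊤
      ctx-coherent {Γ} (R2 c A-d _) =
        subst (Γ ⇓ᶜ_)
          (extend-≡ _ refl (sym (F-▹ 𝐀)) (≅-sym (F-p 𝐀))
            (≅-trans ([]-cong (sym (F-▹ 𝐀)) (≅-sym (F-p 𝐀))) (≡-to-≅ (sym (σ-[] 𝐀 (pᵐ 𝐀)))))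
            (≅-sym (θ-v 𝐀)))
          (ext (ctx-coherent c) (ty-coherent c A-d))
        where
        open Cwf-cong C
        𝐀 : Type Φ (obj c)
        𝐀 = type A-d

      sound : Sound H
      sound = record
        { env  = λ Γ → env (ctx-d Γ)
        ; ctx⇓ = λ Γ → ctx-coherent (ctx-d Γ)
        ; ty⇓  = λ {Γ} A → ty-coherent (ctx-d Γ) (pty-d A)
        ; el⇓  = λ {Γ} {A} a → el-coherent (ctx-d Γ) (pty-d A) (pel-d a)
        ; hom⇓ = λ {Δ} {Γ} f x e → retarget refl (cong (_ ⟦_⟧) (cong F₁ (mor-≡ refl)))
                   (args-coherent (ctx-d Δ) (ctx-d Γ) (els-args f) x e)
        }

    -- Determinacy, substitution and weakening.

    module Functional (ty-ctx  : ∀ {Γ S} (d : tyDecl Γ S ∈ₚ decls Θ) → Γ ⇓ᶜ proj₁ (ty-val d))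
                      (fun-ctx : ∀ {Γ f U} (d : funDecl Γ f U ∈ₚ decls Θ) → Γ ⇓ᶜ proj₁ (fun-val d))
                      where

      -- Both derivations use the same declaration, and by induction their realizers agree on every
      -- variable of its context; `separating` then equates them.
      el-functional : ∀ {X} {ρ : Env X} {a v w} → ρ ⊢ a ⇓ᵉ v → ρ ⊢ a ⇓ᵉ w → v ≡ w
      el-functional (var e) (var e′) = just-injective (trans (sym e) e′)
      el-functional (fn d f _ r) (fn d′ f′ _ r′) with fun-once Θ d d′
      ... | refl , refl with decls-prop Θ _ d d′
      ...   | refl = cong (proj₂ (fun-val d) ⟦_⟧)
                       (separating (fun-ctx d) f f′ λ x e → el-functional (r x e) (r′ x e))

      realizer-unique : ∀ {Γ W X} {ρ : Env X} as {f g : C.Hom X (proj₁ W)} → Γ ⇓ᶜ W →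
                        Realizes ρ as (OV Γ) W f → Realizes ρ as (OV Γ) W g → f ≡ g
      realizer-unique as c r r′ = separating c _ _ λ x e → el-functional (r x e) (r′ x e)

      ty-functional : ∀ {X} {ρ : Env X} {A 𝐀 𝐁} → ρ ⊢ A ⇓ᵗ 𝐀 → ρ ⊢ A ⇓ᵗ 𝐁 → 𝐀 ≡ 𝐁
      ty-functional (ty {as = as} d f _ r) (ty d′ f′ _ r′) with ty-once Θ d d′
      ... | refl with decls-prop Θ _ d d′
      ...   | refl = cong (proj₂ (ty-val d) C.[_]) (realizer-unique as (ty-ctx d) r r′)

      ctx-functional : ∀ {Γ W W′} → Γ ⇓ᶜ W → Γ ⇓ᶜ W′ → W ≡ W′
      ctx-functional ⟨⟩ ⟨⟩ = refl
      ctx-functional (ext c A) (ext c′ A′) with ctx-functional c c′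
      ... | refl with ty-functional A A′
      ...   | refl = refl

      ty-≅ : ∀ {Γ W W′ A 𝐀 𝐁} → Γ ⇓ᶜ W → Γ ⇓ᶜ W′ →
             proj₂ W ⊢ A ⇓ᵗ 𝐀 → proj₂ W′ ⊢ A ⇓ᵗ 𝐁 → 𝐀 ≅ 𝐁
      ty-≅ c c′ d d′ with ctx-functional c c′
      ... | refl = ≡-to-≅ (ty-functional d d′)

      -- Both morphisms yield values of the same raw expressions. The worlds are equated first,
      -- since all other values are typed over them.
      sound-unique : ∀ {Sig} {H K : CwfMor (ℱ Sig) C} → Sound H → Sound K → H ≈ K
      sound-unique {Sig} {H} {K} s s′ = record
        { ≈-Ob  = λ Γ → cong proj₁ (world-≡ Γ)
        ; ≈-Hom = λ {Δ} {Γ} f →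
            hom-≅ (els f) (world-≡ Δ) (world-≡ Γ) (S.ctx⇓ Γ) (S.hom⇓ f) (S′.hom⇓ f)
        ; ≈-Ty  = λ {Γ} A → ty-≅ (S.ctx⇓ Γ) (S′.ctx⇓ Γ) (S.ty⇓ A) (S′.ty⇓ A)
        ; ≈-Tm  = λ {Γ} a → el-≅ (world-≡ Γ) (S.el⇓ a) (S′.el⇓ a)
        }
        where
        module S = Sound s
        module S′ = Sound s′
        world-≡ : ∀ Γ → (CwfMor.F₀ H Γ , S.env Γ) ≡ (CwfMor.F₀ K Γ , S′.env Γ)
        world-≡ Γ = ctx-functional (S.ctx⇓ Γ) (S′.ctx⇓ Γ)
        hom-≅ : ∀ {W W′ Γ Z Z′}
                {f : C.Hom (proj₁ W) (proj₁ Z)} {g : C.Hom (proj₁ W′) (proj₁ Z′)} as → W ≡ W′ → Z ≡ Z′ → Γ ⇓ᶜ Z → Realizes (proj₂ W) as (OV Γ) Z f →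
                Realizes (proj₂ W′) as (OV Γ) Z′ g → f ≅ g
        hom-≅ as refl refl c r r′ = ≡-to-≅ (realizer-unique as c r r′)
        el-≅ : ∀ {W W′ a v w} → W ≡ W′ → proj₂ W ⊢ a ⇓ᵉ v → proj₂ W′ ⊢ a ⇓ᵉ w →
               proj₂ v ≅ proj₂ w
        el-≅ refl d d′ = tm-≅ (el-functional d d′)

      module _ {X Y : C.Ob} {ρ : Env X} {ρ′ : Env Y} {bs ys} {g : C.Hom Y X}
               (r : Realizes ρ′ bs ys (X , ρ) g) where
        -- Reindexing along `g` replaces a realizer `f` by `f ∘ g`. That this realizes the
        -- substituted arguments is `compᵛ`, applicable because a variable with a value occurs in
        -- the context.
        el-subst : ∀ {a w} → ρ ⊢ a ⇓ᵉ w → ρ′ ⊢ a [ bs / ys ]ₑ ⇓ᵉ w ⟦ g ⟧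
        realizes-∘ : ∀ {Γ W f} as → Γ ⇓ᶜ W → length as ≡ length (OV Γ) →
                     Realizes ρ as (OV Γ) W f →
                     Realizes ρ′ (as [ bs / ys ]ₛ) (OV Γ) W (f C.∘ g)
        el-subst (var e) = r _ e
        el-subst (fn {as = as} d f l q) =
          retarget refl (⟦∘⟧ (proj₂ (fun-val d)) f g)
            (fn d (f C.∘ g) (trans ([]ₛ-length as bs ys) l) (realizes-∘ as (fun-ctx d) l q))
        realizes-∘ {Γ} {W} {f} as c l q x {w} e =
          retarget (compᵛ as bs (OV Γ) ys l (env-dom c e)) (sym (⟦∘⟧ w f g)) (el-subst (q x e))

        ty-subst : ∀ {A 𝐀} → ρ ⊢ A ⇓ᵗ 𝐀 → ρ′ ⊢ A [ bs / ys ]ₜ ⇓ᵗ 𝐀 C.[ g ]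
        ty-subst (ty {as = as} d f l q) =
          retargetᵗ refl (C.[∘] (proj₂ (ty-val d)) f g)
            (ty d (f C.∘ g) (trans ([]ₛ-length as bs ys) l) (realizes-∘ as (ty-ctx d) l q))

      realizes-id : ∀ {X} (ρ : Env X) xs → Realizes ρ (map var xs) xs (X , ρ) C.id
      realizes-id ρ xs x {w} e = retarget (sym (idᵛ x xs)) (sym (⟦id⟧ w)) (var e)

      realizes-p : ∀ {Γ W} 𝐀 xs → Γ ⇓ᶜ W →
                   Realizes (proj₂ (cons (fresh Γ) W 𝐀)) (map var xs) xs W (C.p 𝐀)
      realizes-p {Γ} {W} 𝐀 xs c x e =
        retarget (sym (idᵛ x xs)) refl
          (var (extend-tail (C.p 𝐀) (var₀ 𝐀) (proj₂ W) (env-fresh c e) e))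

      ty-weaken : ∀ {Γ W A 𝐀} 𝐁 → Γ ⇓ᶜ W → proj₂ W ⊢ A ⇓ᵗ 𝐀 →
                  proj₂ (cons (fresh Γ) W 𝐁) ⊢ A ⇓ᵗ 𝐀 C.[ C.p 𝐁 ]
      -- With the empty list of variables the substitution leaves `A` as it is, while values still
      -- move along the projection.
      ty-weaken {A = A} 𝐁 c A⇓ = retargetᵗ (idₜ A []) refl (ty-subst (realizes-p 𝐁 [] c) A⇓)

      entry-total : ∀ {Γ W x A} → Γ ⇓ᶜ W → x ∶ A ∈ᶜ Γ →
                    ∃ λ w → proj₂ W ⊢ A ⇓ᵗ proj₁ w × proj₂ W x ≡ just w
      entry-total (ext {Γ} {W = W} {𝐀} c A) last =
        var₀ 𝐀 , ty-weaken 𝐀 c A , extend-head (C.p 𝐀) (var₀ 𝐀) (fresh Γ) (proj₂ W)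
      entry-total (ext {W = W} {𝐀} c B) (earlier l) with entry-total c l
      ... | w , A⇓ , e =
        w ⟦ C.p 𝐀 ⟧ , ty-weaken 𝐀 c A⇓ ,
        extend-tail (C.p 𝐀) (var₀ 𝐀) (proj₂ W) (env-fresh c e) e

      -- Totality on derivable judgements and the resulting morphism.

      module Total (fun-ty : ∀ {Γ f U} (d : funDecl Γ f U ∈ₚ decls Θ) →
                             proj₂ (proj₁ (fun-val d)) ⊢ U ⇓ᵗ proj₁ (proj₂ (fun-val d))) where

        -- Contexts arrive with a value, for declared ones from `ty-ctx` and `fun-ctx`, so the
        -- recursion enters only the arguments.
        ty-total   : ∀ {Γ A W} → 𝒥 Θ (A type⟨ Γ ⟩) → Γ ⇓ᶜ W → ∃ λ 𝐀 → proj₂ W ⊢ A ⇓ᵗ 𝐀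
        el-total   : ∀ {Γ a A W} → 𝒥 Θ (a ∶ A ⟨ Γ ⟩) → Γ ⇓ᶜ W →
                     ∃ λ w → proj₂ W ⊢ A ⇓ᵗ proj₁ w × proj₂ W ⊢ a ⇓ᵉ w
        args-total : ∀ {Δ as Γ W W′} → Args Θ Δ as Γ → Γ ⇓ᶜ W → Δ ⇓ᶜ W′ →
                     ∃ λ f → Realizes (proj₂ W′) as (OV Γ) W f
        ty-total (R4 d (ctxMap _ _ as)) c with args-total as (ty-ctx d) c
        ... | f , r = _ , ty d f (args-length as) r
        el-total (R3 _ l) c with entry-total c l
        ... | w , A⇓ , e = w , A⇓ , var e
        el-total (R5 d (ctxMap _ _ as) _) c with args-total as (fun-ctx d) c
        ... | f , r = _ , ty-subst r (fun-ty d) , fn d f (args-length as) r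
        args-total [] ⟨⟩ c′ = C.! , λ _ ()
        args-total (_∷_ {a} a-d as-d) (ext c A⇓) c′ with args-total as-d c c′ | el-total a-d c′
        -- The argument is evaluated over some value of its type; determinacy makes that value the
        -- reindexed context entry, as pairing requires.
        ... | f , r | (𝐁 , u) , B⇓ , a⇓ with ty-functional B⇓ (ty-subst r A⇓)
        ...   | refl = _ , realizes-cons f u c r a⇓

        ctx-total : ∀ {Γ} → 𝒥 Θ (Γ context) → ∃ λ W → Γ ⇓ᶜ W
        ctx-total R1 = _ , ⟨⟩
        ctx-total (R2 c A _) = _ , ext (proj₂ (ctx-total c)) (proj₂ (ty-total A (proj₂ (ctx-total c))))

        private
          world : (Γ : Obj Θ) → World
          world Γ = proj₁ (ctx-total (ctx-d Γ))

          ctx⇓ : (Γ : Obj Θ) → ctx Γ ⇓ᶜ world Γ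
          ctx⇓ Γ = proj₂ (ctx-total (ctx-d Γ))

          σ : ∀ {Γ} → Type Θ Γ → C.Ty (proj₁ (world Γ))
          σ {Γ} A = proj₁ (ty-total (pty-d A) (ctx⇓ Γ))

          ty⇓ : ∀ {Γ} (A : Type Θ Γ) → proj₂ (world Γ) ⊢ pty A ⇓ᵗ σ A
          ty⇓ {Γ} A = proj₂ (ty-total (pty-d A) (ctx⇓ Γ))

          el : ∀ {Γ} {A : Type Θ Γ} (a : Term Θ Γ A) →
               ∃ λ u → proj₂ (world Γ) ⊢ pel a ⇓ᵉ (σ A , u)
          el {Γ} {A} a with el-total (pel-d a) (ctx⇓ Γ)
          ... | (𝐁 , u) , B⇓ , a⇓ with ty-functional B⇓ (ty⇓ A)
          ...   | refl = u , a⇓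

          θ : ∀ {Γ} {A : Type Θ Γ} → Term Θ Γ A → C.Tm (proj₁ (world Γ)) (σ A)
          θ a = proj₁ (el a)

          el⇓ : ∀ {Γ} {A : Type Θ Γ} (a : Term Θ Γ A) →
                proj₂ (world Γ) ⊢ pel a ⇓ᵉ (σ A , θ a)
          el⇓ a = proj₂ (el a)

          F₁ : ∀ {Δ Γ} → Mor Θ Δ Γ → C.Hom (proj₁ (world Δ)) (proj₁ (world Γ))
          F₁ {Δ} {Γ} f = proj₁ (args-total (els-args f) (ctx⇓ Γ) (ctx⇓ Δ))

          hom⇓ : ∀ {Δ Γ} (f : Mor Θ Δ Γ) →
                 Realizes (proj₂ (world Δ)) (els f) (OV (ctx Γ)) (world Γ) (F₁ f)
          hom⇓ {Δ} {Γ} f = proj₂ (args-total (els-args f) (ctx⇓ Γ) (ctx⇓ Δ))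

          -- Laws about `F₁` thus reduce to showing that the other side realizes the same arguments.
          F₁-unique : ∀ {Δ Γ} (f : Mor Θ Δ Γ) {g} →
                      Realizes (proj₂ (world Δ)) (els f) (OV (ctx Γ)) (world Γ) g → F₁ f ≡ g
          F₁-unique {Γ = Γ} f r = realizer-unique (els f) (ctx⇓ Γ) (hom⇓ f) r

          σ-[] : ∀ {Δ Γ} (A : Type Θ Γ) (f : Mor Θ Δ Γ) → σ (A [ f ]ᵗ) ≡ σ A C.[ F₁ f ]
          σ-[] A f = ty-functional (ty⇓ (A [ f ]ᵗ)) (ty-subst (hom⇓ f) (ty⇓ A))

        -- Everything below uses `functor` only through `functor-sound`.
        abstract
          functor : CwfMor (ℱ Sig₀) C
          functor = record
            { F₀   = λ Γ → proj₁ (world Γ)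
            ; F₁   = F₁
            ; F-id = λ {Γ} → F₁-unique (idᵐ {Γ = Γ}) (realizes-id (proj₂ (world Γ)) (OV (ctx Γ)))
            ; F-∘  = λ {_} {_} {Ξ} f g →
                F₁-unique (f ∘ᵐ g) (realizes-∘ (hom⇓ g) (els f) (ctx⇓ Ξ) (els-length f) (hom⇓ f))
            ; F-⊤  = refl
            ; σ    = σ
            ; σ-[] = σ-[]
            ; F-▹  = λ A → refl
            ; F-p  = λ {Γ} A → ≡-to-≅ (F₁-unique (pᵐ A) (realizes-p (σ A) (OV (ctx Γ)) (ctx⇓ Γ)))
            ; θ    = θ
            ; θ-[] = λ a f → tm-≅ (el-functional (el⇓ (a [ f ]ᵉ)) (el-subst (hom⇓ f) (el⇓ a)))
            ; θ-v  = λ {Γ} A → tm-≅ (el-functional (el⇓ (vᵉ A))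
                (var (extend-head (C.p (σ A)) (var₀ (σ A)) (fresh (ctx Γ)) (proj₂ (world Γ)))))
            ; F-⟨⟩ = λ {Δ} {Γ} A f a → ≡-to-≅ (F₁-unique (pairᵐ A f a)
                (realizes-cons (F₁ f) _ (ctx⇓ Γ) (hom⇓ f)
                  (retarget refl
                    (value-≡ (σ-[] A f) (≅-sym (≡-subst-removable (C.Tm _) (σ-[] A f) (θ a))))
                    (el⇓ a))))
            }

          functor-sound : Sound functor
          functor-sound = record
            { env  = λ Γ → proj₂ (world Γ)
            ; ctx⇓ = ctx⇓
            ; ty⇓  = ty⇓
            ; el⇓  = el⇓
            ; hom⇓ = hom⇓
            }

  -- Existence of the extension of `G`.

  module Extension (Sig : Signature) (G : CwfMor (ℱ Sig) C) (S : TySym)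
                   (S∉Σ : Undeclared S (Signature.preSig Sig)) (Γₛ : PreCtx)
                   (Γₛ-d : 𝒥 (Signature.preSig Sig) (Γₛ context))
                   (A : C.Ty (CwfMor.F₀ G (obj Γₛ-d))) where
    open Extend Sig S S∉Σ Γₛ Γₛ-d
    open Signature Sig using (ty-ok; fun-ok)
    private
      Φ = Signature.preSig Sig
      module E = CwfMor E
      module G where
        open CwfMor G public
        open Canonical G public
      module Gen = Generic Sig
      module Gen′ = Generic Sig′

    assignment : Assignment Σ′
    assignment = record
      { ty-val  = λ { (inj₁ d)    → G.world (ty-ok d) , G.σ (Gen.generic-ty d)
                    ; (inj₂ refl) → G.world Γₛ-d , A }
      ; fun-val = λ { (inj₁ d)    → G.world (type-ctx (fun-ok d)) , G.value (Gen.generic-el d _) }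
      }

    open Relation Sig′ assignment
    open Assignment assignment

    private
      -- Old symbols were assigned their generic values under `G`, so agreement holds by `refl`.
      -- This supplies the values of declared contexts and codomains before the extension exists.
      module G-coh = Coherence G Σ⊆Σ′ (λ d → refl) (λ d → _ , refl)

      ty-ctx : ∀ {Γ T} (d : tyDecl Γ T ∈ₚ decls Σ′) → Γ ⇓ᶜ proj₁ (ty-val d)
      ty-ctx (inj₁ d)    = G-coh.ctx-coherent (ty-ok d)
      ty-ctx (inj₂ refl) = G-coh.ctx-coherent Γₛ-d

      fun-ctx : ∀ {Γ f U} (d : funDecl Γ f U ∈ₚ decls Σ′) → Γ ⇓ᶜ proj₁ (fun-val d)
      fun-ctx (inj₁ d) = G-coh.ctx-coherent (type-ctx (fun-ok d))

      open Functional ty-ctx fun-ctx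

      fun-ty : ∀ {Γ f U} (d : funDecl Γ f U ∈ₚ decls Σ′) →
               proj₂ (proj₁ (fun-val d)) ⊢ U ⇓ᵗ proj₁ (proj₂ (fun-val d))
      fun-ty {Γ} {U = U} (inj₁ d) =
        retargetᵗ (idₜ U (OV Γ)) refl (G-coh.ty-coherent c (pty-d (Gen.codomain d c)))
        where c = type-ctx (fun-ok d)

      open Total fun-ty

    extension : CwfMor (ℱ Sig′) C
    extension = functor

    extension-∘E : extension ∘ᶜ E ≈ G
    extension-∘E =
      sound-unique {Sig} {extension ∘ᶜ E} {G}
        (sound-∘ {Sig} {Sig′} Σ⊆Σ′ {extension} functor-sound) G-coh.sound

    -- The identity realizes the variables of `Γₛ`, so `S-generic` evaluates to `A [ id ]`.
    extension-σ : CwfMor.σ extension S-generic ≅ A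
    extension-σ =
      ty-≅ (Sound.ctx⇓ functor-sound (E.F₀ ⟦Γₛ⟧)) (G-coh.ctx-coherent Γₛ-d)
           (Sound.ty⇓ functor-sound S-generic)
           (retargetᵗ refl (C.[id] A)
             (ty (inj₂ refl) C.id (args-length (id-args Γₛ-d)) (realizes-id _ (OV Γₛ))))

    -- Uniqueness of the extension.

    module Unique (K : CwfMor (ℱ Sig′) C) (K∘E≈G : K ∘ᶜ E ≈ G)
                  (K-σ : CwfMor.σ K S-generic ≅ A) where
      private
        module K where
          open CwfMor K public
          open CwfMor-cong K public
          open Canonical K public
        open _≈_ K∘E≈G

        embed : ∀ {j} → 𝒥 Φ j → 𝒥 Σ′ j
        embed = mono {Φ} {Σ′} Σ⊆Σ′

        value-≅ : ∀ {X Y} {v : Value X} {w : Value Y} → X ≡ Y → proj₁ v ≅ proj₁ w →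
                  proj₂ v ≅ proj₂ w → v ≅ w
        value-≅ refl refl refl = refl

        -- `K∘E≈G` does not mention environments, but these are built from images of projections and
        -- generic terms, where it applies. Embedded syntax differs from syntax formed over `Σ′`
        -- only in its derivations, which are unique.
        world-≡ : ∀ {Γ} (c : 𝒥 Φ (Γ context)) → G.world c ≡ K.world (embed c)
        world-≡ R1 = cong (λ X → X , λ _ → nothing) (sym (≈-Ob (obj R1)))
        world-≡ (R2 {Γ} {B} c B-d sc) =
          extend-≡ (fresh Γ) (world-≡ c) (sym (≈-Ob Γ▹B))
            (≅-trans (≅-sym (≈-Hom (pᵐ 𝐁)))
                     (K.F₁-cong refl refl (≡-to-≅ (mor-≡ refl))))
            (≅-trans (≅-sym (≈-Ty (𝐁 [ pᵐ 𝐁 ]ᵗ))) (≡-to-≅ (cong K.σ (type-≡ refl))))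
            (≅-trans (≅-sym (≈-Tm (vᵉ 𝐁)))
                     (K.θ-cong refl (≡-to-≅ (type-≡ refl)) (term-≅ refl refl)))
          where
          𝐁 : Type Φ (obj c)
          𝐁 = type B-d
          Γ▹B = obj c ▹ᵒ 𝐁

        pair-≡ : ∀ {ℓ} {P : C.Ob → Set ℓ} {W W′ : World} {u : P (proj₁ W)} {v : P (proj₁ W′)} →
                 W ≡ W′ → u ≅ v → _≡_ {A = ∃ λ (Z : World) → P (proj₁ Z)} (W , u) (W′ , v)
        pair-≡ refl refl = refl

        ty-gen : ∀ {Γ T} (d : tyDecl Γ T ∈ₚ decls Σ′) →
                 ty-val d ≡ (K.world (Signature.ty-ok Sig′ d) , K.σ (Gen′.generic-ty d))
        ty-gen (inj₁ d) =
          pair-≡ {P = C.Ty} (world-≡ (ty-ok d))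
            (≅-trans (≅-sym (≈-Ty (Gen.generic-ty d))) (≡-to-≅ (cong K.σ (type-≡ refl))))
        -- The generic type of the new symbol is `S-generic`, so `K-σ` is the required agreement.
        ty-gen (inj₂ refl) = pair-≡ {P = C.Ty} (world-≡ Γₛ-d) (≅-sym K-σ)

        fun-gen : ∀ {Γ f U} (d : funDecl Γ f U ∈ₚ decls Σ′) →
                  ∃ λ c → fun-val d ≡ (K.world c , K.value (Gen′.generic-el d c))
        -- The witness is the context derivation chosen in `assignment`, embedded into `Σ′`.
        fun-gen (inj₁ d) = embed c ,
          pair-≡ {P = Value} (world-≡ c)
            (≅-trans (≅-sym (value-≅ (≈-Ob (obj c)) (≈-Ty (Gen.codomain d c))
                                     (≈-Tm (Gen.generic-el d c))))
                     (≡-to-≅ (K.value-cong refl refl)))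
          where c = type-ctx (fun-ok d)

        module K-coh = Coherence K (λ d → d) ty-gen fun-gen

      unique : extension ≈ K
      unique = sound-unique functor-sound K-coh.sound

mainTheorem14 : (TySym FunSym : Set) →
    let open Syntax TySym FunSym in
    {o h t m : Level} (C : Cwf o h t m) →
    (Sig : Signature) (G : CwfMor (ℱ Sig) C) →
    (S : TySym) (S∉Σ : Undeclared S (Signature.preSig Sig)) →
    (Γₛ : PreCtx) (Γₛ-d : 𝒥 (Signature.preSig Sig) (Γₛ context)) →
    let open Extend Sig S S∉Σ Γₛ Γₛ-d in
    (A : Cwf.Ty C (CwfMor.F₀ G ⟦Γₛ⟧)) →
    ∃! _≈_ (λ (G′ : CwfMor (ℱ Sig′) C) →
    (G′ ∘ᶜ E ≈ G) × (CwfMor.σ G′ S-generic ≅ A))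
mainTheorem14 TySym FunSym C Sig G S S∉Σ Γₛ Γₛ-d A =
  extension , (extension-∘E , extension-σ) ,
  λ {K} (K∘E≈G , K-σ) → Unique.unique K K∘E≈G K-σ
  where open Interpretation.Extension TySym FunSym C Sig G S S∉Σ Γₛ Γₛ-d A
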